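{- Let $p$ be a prime, $q(x)\in\mathbb{Z}[x]$ a monic polynomial of degree $n>0$, and $q_0(x)\in\mathbb{F}_p[x]$ the reduction of $q(x)$ modulo $p$. Then: (1) $q_0(x)$ is irreducible in $\mathbb{F}_p[x]$ if and only if $D_{q(x)}(x_0,\ldots,x_{n-1})\equiv0\pmod p$ has no non-trivial solution in $\mathbb{Z}^n$ (non-trivial meaning not all $x_i$ divisible by $p$); (2) if $q(x)$ is reducible in $\mathbb{Q}[x]$, then $D_{q(x)}(\bar x)=0$ has a solution $\bar x\in\mathbb{Z}^n\setminus\{0\}$; (3) if $n\geq2$ and $q_0(x)\equiv0\pmod p$ has a solution, then $D_{q(x)}(x_0,\ldots,x_{n-1})\equiv0\pmod p$ has a solution in $\mathbb{Z}^n$, not all $x_i$ zero, with $-p^{1/n}<x_i<p^{1/n}$ for all $i$; (4) if $n\geq2$ and $q_0(x)$ is irreducible in $\mathbb{F}_p[x]$, then $D_{q(x)}(\bar x)=p$ has no solution in $\mathbb{Z}^n$.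
   Context: Let $\mathbb{Z}_{q(x)}=\mathbb{Z}[x]/(q(x))$ and $u=x\bmod (q(x))$; it is a free $\mathbb{Z}$-module with basis $1,u,\ldots,u^{n-1}$. For $\bar x=(x_0,\ldots,x_{n-1})\in\mathbb{Z}^n$ let $z=\sum_{i<n}x_iu^i$, let $M_{q(x)}(z)$ be the matrix (with respect to the basis $1,u,\ldots,u^{n-1}$) of the $\mathbb{Z}$-linear map $w\mapsto zw$ on $\mathbb{Z}_{q(x)}$, and $D_{q(x)}(\bar x)=\det M_{q(x)}(z)$. -}

module Defs where

open import Data.Nat as ℕ using (ℕ; zero; suc)
open import Data.Fin using (Fin; zero; suc; toℕ; fromℕ; inject₁; punchIn)
open import Data.List using (List; []; _∷_; _++_; replicate; map)
open import Data.Vec.Functional using (Vector; toList)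
open import Data.Integer as ℤ using (ℤ; +_; -_; _-_)
open import Data.Integer.Divisibility as ℤd using ()
open import Data.Rational as ℚ using (ℚ)
open import Data.Product using (Σ; ∃; _×_; _,_)
open import Relation.Nullary using (¬_)
open import Relation.Binary.PropositionalEquality using (_≡_; _≢_)

-- Univariate polynomials as coefficient lists (lowest degree first),
-- over a commutative ring given by its operations.

module Poly {A : Set} (0# : A) (_+_ _*_ : A → A → A) where

  coeff : List A → ℕ → A
  coeff []       _       = 0#
  coeff (a ∷ as) zero    = a
  coeff (a ∷ as) (suc k) = coeff as k

  addP : List A → List A → List A
  addP []       bs       = bs
  addP as       []       = as
  addP (a ∷ as) (b ∷ bs) = (a + b) ∷ addP as bs

  mulP : List A → List A → List A
  mulP []       bs = []
  mulP (a ∷ as) bs = addP (map (a *_) bs) (0# ∷ mulP as bs)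

module PZ = Poly (+ 0) ℤ._+_ ℤ._*_
module PQ = Poly ℚ.0ℚ ℚ._+_ ℚ._*_

-- A monic polynomial of degree n over ℤ is given by its lower
-- coefficients c : Fin n → ℤ :  q(x) = x^n + Σ_{i<n} c i x^i.

monicList : ∀ {n} → Vector ℤ n → List ℤ
monicList c = toList c ++ (+ 1 ∷ [])

evalZ : List ℤ → ℤ → ℤ
evalZ []       a = + 0
evalZ (b ∷ bs) a = b ℤ.+ a ℤ.* evalZ bs a

-- The ring ℤ_{q(x)} = ℤ[x]/(q(x)), elements represented by their
-- coordinates w.r.t. the ℤ-basis 1, u, …, u^{n-1}.

-- multiplication by u (using u^n = - Σ c i u^i)
mulU : ∀ {n} → Vector ℤ n → Vector ℤ n → Vector ℤ n
mulU {zero}  c w ()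
mulU {suc m} c w zero    = - (c zero ℤ.* w (fromℕ m))
mulU {suc m} c w (suc j) = w (inject₁ j) - c (suc j) ℤ.* w (fromℕ m)

constQ : ∀ {n} → ℤ → Vector ℤ n
constQ {zero}  a ()
constQ {suc m} a zero    = a
constQ {suc m} a (suc _) = + 0

addQ : ∀ {n} → Vector ℤ n → Vector ℤ n → Vector ℤ n
addQ v w i = v i ℤ.+ w i

-- image of a polynomial in ℤ[x] under ℤ[x] → ℤ_{q(x)}, x ↦ u  (Horner)
image : ∀ {n} → Vector ℤ n → List ℤ → Vector ℤ n
image c []       = constQ (+ 0)
image c (a ∷ as) = addQ (constQ a) (mulU c (image c as))

-- M_{q(x)}(z) for z = Σ x_i u^i: column j is the coordinate vector of
-- z·u^j, the image of the polynomial x^j · Σ x_i x^i.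
multMatrix : ∀ {n} → Vector ℤ n → Vector ℤ n → Fin n → Fin n → ℤ
multMatrix c xs i j = image c (replicate (toℕ j) (+ 0) ++ toList xs) i

det : ∀ n → (Fin n → Fin n → ℤ) → ℤ
det zero    M = + 1
det (suc n) M = go n (λ j → j) 
  where
  term : Fin (suc n) → ℤ
  term j = M zero j ℤ.* det n (λ i k → M (suc i) (punchIn j k))
  sign : ℕ → ℤ → ℤ
  sign zero    a = a
  sign (suc k) a = - sign k a
  go : ∀ m → (Fin (suc m) → Fin (suc n)) → ℤ
  go zero    f = sign (toℕ (f zero)) (term (f zero))
  go (suc m) f = sign (toℕ (f zero)) (term (f zero)) ℤ.+ go m (λ k → f (suc k))

D : ∀ {n} → Vector ℤ n → Vector ℤ n → ℤ
D {n} c xs = det n (multMatrix c xs)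

-- Irreducibility of the reduction q₀ ∈ 𝔽_p[x].
-- Polynomials over 𝔽_p are represented by integer coefficient lists,
-- equality in 𝔽_p[x] being coefficientwise congruence mod p.

_≡ₚ_[mod_] : List ℤ → List ℤ → ℕ → Set
a ≡ₚ b [mod p ] = ∀ k → (+ p) ℤd.∣ (PZ.coeff a k - PZ.coeff b k)

NonConstMod : ℕ → List ℤ → Set
NonConstMod p a = ∃ λ k → ¬ ((+ p) ℤd.∣ PZ.coeff a (suc k))

-- f is reducible in 𝔽_p[x]: a product of two non-units.
-- (Since f is monic of positive degree here, it is nonzero and a non-unit;
--  the non-units among the nonzero factors are exactly the nonconstant ones.)
ReducibleModP : ℕ → List ℤ → Set
ReducibleModP p f = ∃ λ a → ∃ λ b → NonConstMod p a × NonConstMod p b × (PZ.mulP a b ≡ₚ f [mod p ])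

IrreducibleModP : ℕ → List ℤ → Set
IrreducibleModP p f = ¬ ReducibleModP p f

NonConstQ : List ℚ → Set
NonConstQ a = ∃ λ k → PQ.coeff a (suc k) ≢ ℚ.0ℚ

toQ : List ℤ → List ℚ
toQ = map (λ z → z ℚ./ 1)

ReducibleQ : List ℤ → Set
ReducibleQ f = ∃ λ a → ∃ λ b → NonConstQ a × NonConstQ b × (∀ k → PQ.coeff (PQ.mulP a b) k ≡ PQ.coeff (toQ f) k)

{-# OPTIONS --safe #-}

-- Multiplication by polynomials in ℤ[x]/(q) gives a multiplicative norm f ↦ det (w ↦ f w), and D is the norm of Σ xᵢ uⁱ.
-- Multiplicativity of det follows from the uniqueness of alternating multilinear functions of the rows.
-- If a b is a multiple of q modulo m (m prime, or m = 0), then m divides N(a) N(b), hence N(a) or N(b): this gives (2) and one half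
-- of (1).  Conversely, if q is irreducible mod p and z ≢ 0 has degree < n, make z monic and divide, q = h z + r; then r ≢ 0 and
-- N(r) = N(-h z), so p ∣ N(z) would imply p ∣ N(r), and one descends to degree 0, where N is 1.
-- For (3), two of the more than p polynomials with coefficients in [0, r], r < p^(1/n) < r + 1, have the same value mod p at the
-- root a; their difference z vanishes at a, so the row (1, a, a², …) annihilates the matrix of z mod p.
-- For (4), by (1) all xᵢ are divisible by p, hence p² ∣ D as n ≥ 2.

module Submission where

open import Defs
open import Data.Nat as ℕ using (ℕ; zero; suc; _<_; _≤_; _^_; s≤s; z≤n)
import Data.Nat.Properties as ℕ
import Data.Nat.Divisibility as ℕ
open import Data.Nat.Primality using (Prime; euclidsLemma; prime⇒irreducible; prime⇒nonTrivial; prime⇒nonZero)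
open import Data.Nat.Coprimality using (Coprime; coprime-Bézout)
open import Data.Nat.GCD using (module Bézout)
open import Data.Nat.Induction using (<-wellFounded)
open import Data.Fin using (Fin; zero; suc; toℕ; fromℕ; fromℕ<; inject₁; punchIn; punchOut; combine; finToFun; funToFin)
open import Data.Fin.Properties using (punchOut-punchIn; punchInᵢ≢i; punchOut-cong; punchIn-punchOut; suc-injective; toℕ-inject₁; toℕ-fromℕ; toℕ-fromℕ<; fromℕ≢inject₁; pigeonhole; ¬∀⟶∃¬; funToFin-finToFin; toℕ-injective; toℕ≤pred[n]; <⇒≢) renaming (_≟_ to _≟F_)
open import Data.Fin.Induction using (<-weakInduction)
open import Data.List using (List; []; _∷_; _++_; replicate; map)
open import Data.List.Properties using (++-identityʳ; ∷-injectiveˡ; ∷-injectiveʳ)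
open import Data.Vec.Functional using (Vector; updateAt; insertAt; tail; toList) renaming (_∷_ to _◂_)
open import Data.Vec.Functional.Properties using (updateAt-updates; updateAt-minimal; insertAt-lookup; insertAt-punchIn)
open import Data.Integer as ℤ using (ℤ; +_; -_; _+_; _*_; _-_; -[1+_]; ∣_∣)
open import Data.Integer.Properties as ℤ using (+-*-semiring)
open import Data.Integer.DivMod using (_%ℕ_; _/ℕ_; n%ℕd<d; a≡a%ℕn+[a/ℕn]*n)
open import Data.Integer.Divisibility using (_∣_)
open import Data.Integer.Divisibility.Signed using (divides; ∣ᵤ⇒∣; ∣⇒∣ᵤ; _∣?_; ∣m∣n⇒∣m+n; ∣m∣n⇒∣m-n; ∣m⇒∣m*n; ∣n⇒∣m*n; ∣m⇒∣-m; *-monoʳ-∣; *-monoˡ-∣; *-cancelˡ-∣; 0∣⇒≡0; ∣-trans) renaming (_∣_ to _∣ˢ_)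
open import Data.Integer.Tactic.RingSolver using (solve-∀)
open import Data.Rational as ℚ using (ℚ; mkℚ; toℚᵘ)
import Data.Rational.Properties as ℚ
open import Data.Rational.Unnormalised as ℚᵘ using (mkℚᵘ; *≡*)
import Data.Rational.Unnormalised.Properties as ℚᵘ
open import Data.Product using (∃; _×_; _,_; proj₁; proj₂)
open import Data.Sum using (_⊎_; inj₁; inj₂)
open import Data.Unit using (⊤; tt)
open import Data.Empty using (⊥-elim)
open import Function using (_∘_; const)
open import Function.Bundles using (_⇔_; mk⇔)
open import Induction.WellFounded using (Acc; acc)
open import Relation.Nullary using (¬_; Dec; yes; no)
open import Relation.Binary.Definitions using (Tri; tri<; tri≈; tri>)
open import Relation.Binary.PropositionalEquality using (_≡_; _≢_; _≗_; refl; sym; trans; cong; cong₂; subst; subst₂; module ≡-Reasoning)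
open import Algebra.Bundles using (CommutativeMonoid)
open import Algebra.Properties.CommutativeSemigroup (CommutativeMonoid.commutativeSemigroup ℚ.*-1-commutativeMonoid) using (interchange)
open import Algebra.Properties.Semiring.Sum +-*-semiring using (sum; sum-syntax; sum-cong-≗; ∑-distrib-+; *-distribˡ-sum; *-distribʳ-sum; ∑-comm; sum-remove; sum-replicate-zero)

-- Everything stays over the integers: reduction mod m is only a relation on ℤ compatible with sums
-- and products, and the same lemmas are instantiated with equality and with congruence. The norm is
-- taken of arbitrary coefficient lists rather than of residues of degree below n, so that products
-- need no reduction before multiplicativity is applied, and a list may be replaced by any other
-- with congruent coefficients. Since the determinant is given by expansion along the first row, its
-- properties are derived for rows, and the uniqueness theorem stands in for the permutation
-- formula. Division by a monic polynomial costs little extra: the remainder of f is the coordinate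
-- vector of f in the quotient ring of the divisor.

-- Laplace expansion along the first row

Matrix : ℕ → ℕ → Set
Matrix m n = Fin m → Fin n → ℤ

-- The where-function go of det cannot be named from outside, so it is recovered as the solution of metavariables, which needs
-- a goal in which all arguments of go are distinct variables.  Unfolding det (suc (suc m)) M leaves go (suc m) M m suc, and
-- abstracting suc gives go₁.  To abstract suc m as well without changing the type Fin (suc m) → _ of the last argument, m is
-- written h x in one place and h y in the other: these are convertible because ⊤ has η, but only suc (h x) is abstracted.
private
  mutual
    go₁ : ∀ m → Matrix (suc (suc m)) (suc (suc m)) → (Fin (suc m) → Fin (suc (suc m))) → ℤ
    go₁ m M f = _

    go₁-refl : ∀ m M f → let t = M zero zero * det (suc m) (λ i k → M (suc i) (suc k)) in
      t + go₁ m M f ≡ t + go₁ m M f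
    go₁-refl m M f = refl

    go₁-solution : ∀ m M → det (suc (suc m)) M ≡ det (suc (suc m)) M
    go₁-solution m M with (λ (k : Fin (suc m)) → Fin.suc k)
    ... | f = go₁-refl m M f

  mutual
    go₂ : (h : ⊤ → ℕ) (x y : ⊤) (n : ℕ) → Matrix (suc n) (suc n) → (Fin (suc (h y)) → Fin (suc n)) → ℤ
    go₂ h x y n M f = _

    go₂-refl : ∀ h x y n M f → go₂ h x y n M f ≡ go₂ h x y n M f
    go₂-refl h x y n M f = refl

    go₂-solution : (h : ⊤ → ℕ) (x y : ⊤) (M : Matrix (suc (suc (h x))) (suc (suc (h x))))
      (f : Fin (suc (h y)) → Fin (suc (suc (h x)))) → go₁ (h x) M f ≡ go₁ (h x) M f
    go₂-solution h x y with ℕ.suc (h x)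
    ... | n = λ M f → go₂-refl h x y n M f

  go : ∀ n → Matrix (suc n) (suc n) → (m : ℕ) → (Fin (suc m) → Fin (suc n)) → ℤ
  go n M m f = go₂ (const m) tt tt n M f

  mutual
    sign : ∀ n → Matrix (suc n) (suc n) → ℕ → ℤ → ℤ
    sign n M k a = _

    sign-refl : ∀ n M k a → sign n M k a ≡ sign n M k a
    sign-refl n M k a = refl

    sign-solution : ∀ n M (f : Fin 1 → Fin (suc n)) → go n M 0 f ≡ go n M 0 f
    sign-solution n M f
      with toℕ (f zero) | M zero (f zero) * det n (λ i k → M (suc i) (punchIn (f zero) k))
    ... | k | a = sign-refl n M k a

sgn : ℕ → ℤ
sgn zero    = + 1
sgn (suc k) = - sgn k

minor : ∀ {m n} → Matrix (suc m) (suc n) → Fin (suc n) → Matrix m n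
minor M j i k = M (suc i) (punchIn j k)

private
  sign-sgn : ∀ n M k a → sign n M k a ≡ sgn k * a
  sign-sgn n M zero    a = sym (ℤ.*-identityˡ a)
  sign-sgn n M (suc k) a = trans (cong -_ (sign-sgn n M k a)) (ℤ.neg-distribˡ-* (sgn k) a)

  go-sum : ∀ n M m f → go n M m f ≡ ∑[ i < suc m ] (sgn (toℕ (f i)) * (M zero (f i) * det n (minor M (f i))))
  go-sum n M zero    f = trans (sign-sgn n M (toℕ (f zero)) _) (sym (ℤ.+-identityʳ _))
  go-sum n M (suc m) f = cong₂ _+_ (sign-sgn n M (toℕ (f zero)) _) (go-sum n M m (f ∘ suc))

-- Together with the value 1 in size 0, this is all that the rest of the proof uses about `det`.
det-laplace : ∀ n M → det (suc n) M ≡ ∑[ j < suc n ] (sgn (toℕ j) * (M zero j * det n (minor M j)))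
det-laplace n M = go-sum n M n (λ j → j)

-- Relations compatible with the ring operations

-- Determinants and products of polynomials are built from entries and coefficients by sums and
-- products, so these closure properties carry the relation through them.
record IsCongruence (_~_ : ℤ → ℤ → Set) : Set where
  field
    ~-refl : ∀ {x} → x ~ x
    +-~    : ∀ {w x y z} → w ~ x → y ~ z → (w + y) ~ (x + z)
    *-~    : ∀ {w x y z} → w ~ x → y ~ z → (w * y) ~ (x * z)

  neg-~ : ∀ {x y} → x ~ y → (- x) ~ (- y)
  neg-~ {x} {y} x~y = subst₂ _~_ (ℤ.-1*i≡-i x) (ℤ.-1*i≡-i y) (*-~ (~-refl {ℤ.-1ℤ}) x~y)

  sum-~ : ∀ {n} {f g : Vector ℤ n} → (∀ i → f i ~ g i) → sum f ~ sum g
  sum-~ {zero}  f~g = ~-refl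
  sum-~ {suc n} f~g = +-~ (f~g zero) (sum-~ (f~g ∘ suc))

  det-~ : ∀ n {A B : Matrix n n} → (∀ i j → A i j ~ B i j) → det n A ~ det n B
  det-~ zero    A~B = ~-refl
  det-~ (suc n) {A} {B} A~B = subst₂ _~_ (sym (det-laplace n A)) (sym (det-laplace n B))
    (sum-~ λ j → *-~ (~-refl {sgn (toℕ j)}) (*-~ (A~B zero j) (det-~ n λ i k → A~B (suc i) (punchIn j k))))

≡-isCongruence : IsCongruence _≡_
≡-isCongruence = record { ~-refl = refl ; +-~ = cong₂ _+_ ; *-~ = cong₂ _*_ }

open IsCongruence ≡-isCongruence using () renaming (det-~ to det-cong)

-- Finite sums and the identity matrix

sum-zero : ∀ {n} {f : Vector ℤ n} → (∀ i → f i ≡ + 0) → sum f ≡ + 0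
sum-zero {n} f≡0 = trans (sum-cong-≗ f≡0) (sum-replicate-zero n)

sum-linear : ∀ {n} x y {f g h : Vector ℤ n} → (∀ i → f i ≡ x * g i + y * h i) → sum f ≡ x * sum g + y * sum h
sum-linear x y {f} {g} {h} f≡ = trans (sum-cong-≗ f≡) (trans (∑-distrib-+ (λ i → x * g i) (λ i → y * h i))
  (cong₂ _+_ (sym (*-distribˡ-sum x g)) (sym (*-distribˡ-sum y h))))

1*+1* : ∀ x y → + 1 * x + + 1 * y ≡ x + y
1*+1* x y = cong₂ _+_ (ℤ.*-identityˡ x) (ℤ.*-identityˡ y)

-- Recursion on both indices, instead of a decision of equality, makes the minor of `δ` at position
-- zero reduce to `δ` by computation.
δ : ∀ {m n} → Fin m → Fin n → ℤ
δ zero    zero    = + 1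
δ zero    (suc j) = + 0
δ (suc i) zero    = + 0
δ (suc i) (suc j) = δ i j

δ-refl : ∀ {n} (i : Fin n) → δ i i ≡ + 1
δ-refl zero    = refl
δ-refl (suc i) = δ-refl i

δ-≢ : ∀ {n} {i j : Fin n} → i ≢ j → δ i j ≡ + 0
δ-≢ {i = zero}  {zero}  i≢j = ⊥-elim (i≢j refl)
δ-≢ {i = zero}  {suc j} i≢j = refl
δ-≢ {i = suc i} {zero}  i≢j = refl
δ-≢ {i = suc i} {suc j} i≢j = δ-≢ (i≢j ∘ cong suc)

sum-δ : ∀ {n} (i : Fin n) (v : Vector ℤ n) → ∑[ j < n ] (δ i j * v j) ≡ v i
sum-δ zero    v = trans (cong₂ _+_ (ℤ.*-identityˡ (v zero)) (sum-zero λ j → ℤ.*-zeroˡ (v (suc j)))) (ℤ.+-identityʳ _)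
sum-δ (suc i) v = trans (cong₂ _+_ (ℤ.*-zeroˡ (v zero)) (sum-δ i (v ∘ suc))) (ℤ.+-identityˡ (v (suc i)))

det-δ : ∀ n → det n δ ≡ + 1
det-δ zero    = refl
det-δ (suc n) = begin
  det (suc n) δ                                                            ≡⟨ det-laplace n δ ⟩
  ∑[ j < suc n ] (sgn (toℕ j) * (δ {suc n} zero j * det n (minor δ j)))    ≡⟨ sum-cong-≗ (λ j → swap (sgn (toℕ j)) (δ {suc n} zero j) (det n (minor δ j))) ⟩
  ∑[ j < suc n ] (δ {suc n} zero j * (sgn (toℕ j) * det n (minor δ j)))    ≡⟨ sum-δ {suc n} zero (λ j → sgn (toℕ j) * det n (minor δ j)) ⟩
  + 1 * det n δ                                                            ≡⟨ ℤ.*-identityˡ _ ⟩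
  det n δ                                                                  ≡⟨ det-δ n ⟩
  + 1                                                                      ∎
  where
  open ≡-Reasoning
  swap : ∀ a b c → a * (b * c) ≡ b * (a * c)
  swap = solve-∀

-- Alternating multilinear functions of the rows

setRow : ∀ {m n} → Matrix m n → Fin m → Vector ℤ n → Matrix m n
setRow A i v = updateAt A i (const v)

module _ {m n : ℕ} {A : Matrix m n} {i : Fin m} {v : Vector ℤ n} where
  setRow-at : setRow A i v i ≡ v
  setRow-at = updateAt-updates i A

  setRow-off : ∀ {k} → k ≢ i → setRow A i v k ≡ A k
  setRow-off {k} k≢i = updateAt-minimal k i A k≢i

-- Matrices are functions compared entry by entry, hence the field `ext`. In `lin` the three
-- matrices merely agree off row i, so it applies without presenting any of them as an update of
-- another.
record Alternating {m n} (F : Matrix m n → ℤ) : Set where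
  field
    ext : ∀ {A B} → (∀ i → A i ≗ B i) → F A ≡ F B
    lin : ∀ {A B C} i x y → (∀ k → k ≢ i → A k ≗ B k) → (∀ k → k ≢ i → A k ≗ C k) →
          (∀ j → A i j ≡ x * B i j + y * C i j) → F A ≡ x * F B + y * F C
    alt : ∀ {A} i k → i ≢ k → A i ≗ A k → F A ≡ + 0

  private
    ≗-reflexive : {u v : Vector ℤ n} → u ≡ v → u ≗ v
    ≗-reflexive refl j = refl

  lin-setRow : ∀ {A} i u v w → (∀ j → u j ≡ v j + w j) → F (setRow A i u) ≡ F (setRow A i v) + F (setRow A i w)
  lin-setRow {A} i u v w u≡v+w = trans (lin i (+ 1) (+ 1) (off u v) (off u w) at) (1*+1* (F (setRow A i v)) (F (setRow A i w)))
    where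
    off : ∀ u v k → k ≢ i → setRow A i u k ≗ setRow A i v k
    off u v k k≢i = ≗-reflexive (trans (setRow-off {A = A} k≢i) (sym (setRow-off {A = A} k≢i)))
    at : ∀ j → setRow A i u i j ≡ + 1 * setRow A i v i j + + 1 * setRow A i w i j
    at j rewrite setRow-at {A = A} {i} {u} | setRow-at {A = A} {i} {v} | setRow-at {A = A} {i} {w}
      = trans (u≡v+w j) (sym (1*+1* (v j) (w j)))

  -- Put u + v into both rows i and k: F vanishes there, and expanding bilinearly leaves F(u, v) +
  -- F(v, u), because the terms F(u, u) and F(v, v) vanish too.
  swap : ∀ {A B} i k → i ≢ k → B i ≗ A k → B k ≗ A i → (∀ l → l ≢ i → l ≢ k → B l ≗ A l) → F B ≡ - F A
  swap {A} {B} i k i≢k Bi Bk Bl = begin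
    F B               ≡⟨ ext B≗ ⟩
    F (X v u)         ≡⟨ rearrange (F (X u v)) (F (X v u)) ⟩
    F (X u v) + F (X v u) - F (X u v) ≡⟨ cong (_- F (X u v)) sum≡0 ⟩
    + 0 - F (X u v)   ≡⟨ ℤ.+-identityˡ _ ⟩
    - F (X u v)       ≡⟨ cong -_ (ext A≗) ⟩
    - F A             ∎
    where
    open ≡-Reasoning
    u = A i
    v = A k
    s : Vector ℤ n
    s j = u j + v j
    X : Vector ℤ n → Vector ℤ n → Matrix m n
    X p q = setRow (setRow A i p) k q
    X-i : ∀ p q → X p q i ≡ p
    X-i p q = trans (setRow-off {A = setRow A i p} i≢k) (setRow-at {A = A})
    X-k : ∀ p q → X p q k ≡ q
    X-k p q = setRow-at {A = setRow A i p}
    X-off : ∀ p q l → l ≢ i → l ≢ k → X p q l ≡ A l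
    X-off p q l l≢i l≢k = trans (setRow-off {A = setRow A i p} l≢k) (setRow-off {A = A} l≢i)
    X-diag : ∀ p → F (X p p) ≡ + 0
    X-diag p = alt i k i≢k (≗-reflexive (trans (X-i p p) (sym (X-k p p))))
    X-lin : ∀ q → F (X s q) ≡ F (X u q) + F (X v q)
    X-lin q = trans (lin i (+ 1) (+ 1) (off s u) (off s v) at) (1*+1* (F (X u q)) (F (X v q)))
      where
      off : ∀ p p′ l → l ≢ i → X p q l ≗ X p′ q l
      off p p′ l l≢i with l ≟F k
      ... | yes refl = ≗-reflexive (trans (X-k p q) (sym (X-k p′ q)))
      ... | no l≢k = ≗-reflexive (trans (X-off p q l l≢i l≢k) (sym (X-off p′ q l l≢i l≢k)))
      at : ∀ j → X s q i j ≡ + 1 * X u q i j + + 1 * X v q i j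
      at j rewrite X-i s q | X-i u q | X-i v q = sym (1*+1* (u j) (v j))
    sum≡0 : F (X u v) + F (X v u) ≡ + 0
    sum≡0 = begin
      F (X u v) + F (X v u)                             ≡⟨ pad (F (X u v)) (F (X v u)) ⟩
      (+ 0 + F (X u v)) + (F (X v u) + + 0)             ≡⟨ cong₂ (λ a b → (a + F (X u v)) + (F (X v u) + b)) (X-diag u) (X-diag v) ⟨
      (F (X u u) + F (X u v)) + (F (X v u) + F (X v v)) ≡⟨ cong₂ _+_ (lin-setRow k s u v (λ j → refl)) (lin-setRow k s u v (λ j → refl)) ⟨
      F (X u s) + F (X v s)                             ≡⟨ X-lin s ⟨
      F (X s s)                                         ≡⟨ X-diag s ⟩
      + 0                                               ∎
      where
      pad : ∀ a b → a + b ≡ (+ 0 + a) + (b + + 0)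
      pad = solve-∀
    rearrange : ∀ a b → b ≡ a + b - a
    rearrange = solve-∀
    A≗ : ∀ l → X u v l ≗ A l
    A≗ l with l ≟F i | l ≟F k
    ... | yes refl | _ = ≗-reflexive (X-i u v)
    ... | no l≢i | yes refl = ≗-reflexive (X-k u v)
    ... | no l≢i | no l≢k = ≗-reflexive (X-off u v l l≢i l≢k)
    B≗ : ∀ l → B l ≗ X v u l
    B≗ l j with l ≟F i | l ≟F k
    ... | yes refl | _ = trans (Bi j) (sym (≗-reflexive (X-i v u) j))
    ... | no l≢i | yes refl = trans (Bk j) (sym (≗-reflexive (X-k v u) j))
    ... | no l≢i | no l≢k = trans (Bl l l≢i l≢k j) (sym (≗-reflexive (X-off v u l l≢i l≢k) j))

-- The determinant is alternating

laplace-linear : ∀ {n} {A B C : Matrix (suc n) (suc n)} x y →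
  (∀ j → A zero j * det n (minor A j) ≡ x * (B zero j * det n (minor B j)) + y * (C zero j * det n (minor C j))) →
  det (suc n) A ≡ x * det (suc n) B + y * det (suc n) C
laplace-linear {n} {A} {B} {C} x y eq = begin
  det (suc n) A ≡⟨ det-laplace n A ⟩
  _             ≡⟨ sum-linear x y (λ j → trans (cong (sgn (toℕ j) *_) (eq j)) (distrib (sgn (toℕ j)) x y _ _)) ⟩
  _             ≡⟨ cong₂ (λ b c → x * b + y * c) (det-laplace n B) (det-laplace n C) ⟨
  x * det (suc n) B + y * det (suc n) C ∎
  where
  open ≡-Reasoning
  distrib : ∀ s x y b c → s * (x * b + y * c) ≡ x * (s * b) + y * (s * c)
  distrib = solve-∀

≡-neg⇒≡0 : ∀ x → x ≡ - x → x ≡ + 0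
≡-neg⇒≡0 (+ zero) eq = refl

-- In the twofold Laplace expansion the terms (j , l) and (l , j) have the same minor but opposite signs.
punchIn-punchOut-comm : ∀ {n} {j l : Fin (suc (suc n))} (j≢l : j ≢ l) (l≢j : l ≢ j) (c : Fin n) →
  punchIn j (punchIn (punchOut j≢l) c) ≡ punchIn l (punchIn (punchOut l≢j) c)
punchIn-punchOut-comm {j = zero}  {zero}  j≢l l≢j c = ⊥-elim (j≢l refl)
punchIn-punchOut-comm {j = zero}  {suc l} j≢l l≢j c = refl
punchIn-punchOut-comm {j = suc j} {zero}  j≢l l≢j c = refl
punchIn-punchOut-comm {j = suc j} {suc l} j≢l l≢j zero = refl
punchIn-punchOut-comm {j = suc j} {suc l} j≢l l≢j (suc c) =
  cong suc (punchIn-punchOut-comm (j≢l ∘ cong suc) (l≢j ∘ cong suc) c)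

sgn-punchOut : ∀ {n} {j l : Fin (suc (suc n))} (j≢l : j ≢ l) (l≢j : l ≢ j) →
  sgn (toℕ j) * sgn (toℕ (punchOut j≢l)) ≡ - (sgn (toℕ l) * sgn (toℕ (punchOut l≢j)))
sgn-punchOut {j = zero}  {zero}  j≢l l≢j = ⊥-elim (j≢l refl)
sgn-punchOut {j = zero}  {suc l} j≢l l≢j = lemma (sgn (toℕ l))
  where
  lemma : ∀ s → + 1 * s ≡ - (- s * + 1)
  lemma = solve-∀
sgn-punchOut {j = suc j} {zero}  j≢l l≢j = lemma (sgn (toℕ j))
  where
  lemma : ∀ s → - s * + 1 ≡ - (+ 1 * s)
  lemma = solve-∀
sgn-punchOut {zero}  {suc zero} {suc zero} j≢l l≢j = ⊥-elim (j≢l refl)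
sgn-punchOut {suc n} {suc j} {suc l} j≢l l≢j = begin
  - sj * - sj′   ≡⟨ neg-neg sj sj′ ⟩
  sj * sj′       ≡⟨ sgn-punchOut (j≢l ∘ cong suc) (l≢j ∘ cong suc) ⟩
  - (sl * sl′)   ≡⟨ cong -_ (neg-neg sl sl′) ⟨
  - (- sl * - sl′) ∎
  where
  open ≡-Reasoning
  sj = sgn (toℕ j)
  sl = sgn (toℕ l)
  sj′ = sgn (toℕ (punchOut (j≢l ∘ cong suc)))
  sl′ = sgn (toℕ (punchOut (l≢j ∘ cong suc)))
  neg-neg : ∀ a b → - a * - b ≡ a * b
  neg-neg = solve-∀

det-rows01 : ∀ n {A : Matrix (suc (suc n)) (suc (suc n))} → A zero ≗ A (suc zero) → det (suc (suc n)) A ≡ + 0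
det-rows01 n {A} A0≗A1 = trans det≡S (≡-neg⇒≡0 S S≡-S)
  where
  open ≡-Reasoning
  a = A zero
  d : (j : Fin (suc (suc n))) → Fin (suc n) → ℤ
  d j k = det n (minor (minor A j) k)
  -- The decision is an argument, so that the terms at (j , l) and (l , j) can be compared for any
  -- decisions of `j ≡ l` and `l ≡ j`. The diagonal is filled with 0 to make the double sum run over
  -- a square, where the order of summation can be exchanged.
  term : (j l : Fin (suc (suc n))) → Dec (j ≡ l) → ℤ
  term j l (yes _)  = + 0
  term j l (no j≢l) = sgn (toℕ j) * sgn (toℕ (punchOut j≢l)) * (a j * a l * d j (punchOut j≢l))
  T : (j l : Fin (suc (suc n))) → ℤ
  T j l = term j l (j ≟F l)
  S = ∑[ j < suc (suc n) ] ∑[ l < suc (suc n) ] T j l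

  term-anti : ∀ j l p q → term j l p ≡ - term l j q
  term-anti j l (yes _)   (yes _)   = refl
  term-anti j l (yes j≡l) (no l≢j)  = ⊥-elim (l≢j (sym j≡l))
  term-anti j l (no j≢l)  (yes l≡j) = ⊥-elim (j≢l (sym l≡j))
  term-anti j l (no j≢l)  (no l≢j)  = trans
    (cong₂ (λ s x → s * (a j * a l * x)) (sgn-punchOut j≢l l≢j)
      (det-cong n λ i c → cong (A (suc (suc i))) (punchIn-punchOut-comm j≢l l≢j c)))
    (lemma (sgn (toℕ l) * sgn (toℕ (punchOut l≢j))) (a j) (a l) (d l (punchOut l≢j)))
    where
    lemma : ∀ s x y e → - s * (x * y * e) ≡ - (s * (y * x * e))
    lemma = solve-∀

  S≡-S : S ≡ - S
  S≡-S = begin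
    S ≡⟨ ∑-comm T ⟩
    ∑[ l < suc (suc n) ] ∑[ j < suc (suc n) ] T j l ≡⟨ sum-neg (λ l → sum-neg (λ j → term-anti j l (j ≟F l) (l ≟F j))) ⟩
    - S ∎
    where
    sum-neg : ∀ {m} {f g : Vector ℤ m} → (∀ i → f i ≡ - g i) → sum f ≡ - sum g
    sum-neg {zero}  eq = refl
    sum-neg {suc m} {f} {g} eq = trans (cong₂ _+_ (eq zero) (sum-neg {g = g ∘ suc} (eq ∘ suc))) (sym (ℤ.neg-distrib-+ (g zero) (sum (g ∘ suc))))

  term-diag : ∀ j p → term j j p ≡ + 0
  term-diag j (yes _)  = refl
  term-diag j (no j≢j) = ⊥-elim (j≢j refl)

  term-punchIn : ∀ j k p → term j (punchIn j k) p ≡ sgn (toℕ j) * sgn (toℕ k) * (a j * a (punchIn j k) * d j k)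
  term-punchIn j k (yes eq) = ⊥-elim (punchInᵢ≢i j k (sym eq))
  term-punchIn j k (no neq) = cong (λ k′ → sgn (toℕ j) * sgn (toℕ k′) * (a j * a (punchIn j k) * d j k′))
    (trans (punchOut-cong j refl) (punchOut-punchIn j))

  -- The sum over the columns k of the minor becomes a sum over all columns l = `punchIn j k`, the
  -- missing l = j contributing 0. Equality of the first two rows lets both factors be read from row
  -- zero.
  row : ∀ j → sgn (toℕ j) * (a j * det (suc n) (minor A j)) ≡ ∑[ l < suc (suc n) ] T j l
  row j = begin
    s * (a j * det (suc n) (minor A j))                                   ≡⟨ cong (λ x → s * (a j * x)) (det-laplace n (minor A j)) ⟩
    s * (a j * ∑[ k < suc n ] e k)                                        ≡⟨ ℤ.*-assoc s (a j) _ ⟨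
    s * a j * ∑[ k < suc n ] e k                                          ≡⟨ *-distribˡ-sum (s * a j) e ⟩
    ∑[ k < suc n ] (s * a j * e k)                                        ≡⟨ sum-cong-≗ entry ⟩
    ∑[ k < suc n ] T j (punchIn j k)                                      ≡⟨ ℤ.+-identityˡ _ ⟨
    + 0 + ∑[ k < suc n ] T j (punchIn j k)                                ≡⟨ cong (λ x → x + ∑[ k < suc n ] T j (punchIn j k)) (term-diag j (j ≟F j)) ⟨
    T j j + ∑[ k < suc n ] T j (punchIn j k)                              ≡⟨ sum-remove {i = j} (T j) ⟨
    ∑[ l < suc (suc n) ] T j l                                            ∎
    where
    s = sgn (toℕ j)
    e : Fin (suc n) → ℤ
    e k = sgn (toℕ k) * (A (suc zero) (punchIn j k) * d j k)
    lemma : ∀ s x t y z → s * x * (t * (y * z)) ≡ s * t * (x * y * z)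
    lemma = solve-∀
    entry : ∀ k → s * a j * e k ≡ T j (punchIn j k)
    entry k = begin
      s * a j * e k ≡⟨ cong (λ x → s * a j * (sgn (toℕ k) * (x * d j k))) (A0≗A1 (punchIn j k)) ⟨
      s * a j * (sgn (toℕ k) * (a (punchIn j k) * d j k)) ≡⟨ lemma s (a j) (sgn (toℕ k)) (a (punchIn j k)) (d j k) ⟩
      _ ≡⟨ term-punchIn j k (j ≟F punchIn j k) ⟨
      T j (punchIn j k) ∎

  det≡S : det (suc (suc n)) A ≡ S
  det≡S = trans (det-laplace (suc n) A) (sum-cong-≗ row)

det-alternating : ∀ n → Alternating (det n)
det-alternating zero = record
  { ext = λ _ → refl
  ; lin = λ ()
  ; alt = λ ()
  }
det-alternating (suc n) = record { ext = λ eq → det-cong (suc n) eq ; lin = lin′ ; alt = alt′ }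
  where
  module IH = Alternating (det-alternating n)

  lin′ : ∀ {A B C} i x y → (∀ k → k ≢ i → A k ≗ B k) → (∀ k → k ≢ i → A k ≗ C k) →
         (∀ j → A i j ≡ x * B i j + y * C i j) → det (suc n) A ≡ x * det (suc n) B + y * det (suc n) C
  lin′ {A} {B} {C} zero x y A≗B A≗C eq = laplace-linear {A = A} {B} {C} x y λ j → begin
    A zero j * det n (minor A j)                                        ≡⟨ cong (_* det n (minor A j)) (eq j) ⟩
    (x * B zero j + y * C zero j) * det n (minor A j)                    ≡⟨ distrib x y (B zero j) (C zero j) _ ⟩
    x * (B zero j * det n (minor A j)) + y * (C zero j * det n (minor A j))
      ≡⟨ cong₂ (λ b c → x * (B zero j * b) + y * (C zero j * c))
           (det-cong n (λ i k → A≗B (suc i) (λ ()) (punchIn j k)))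
           (det-cong n (λ i k → A≗C (suc i) (λ ()) (punchIn j k))) ⟩
    x * (B zero j * det n (minor B j)) + y * (C zero j * det n (minor C j)) ∎
    where
    open ≡-Reasoning
    distrib : ∀ x y b c d → (x * b + y * c) * d ≡ x * (b * d) + y * (c * d)
    distrib = solve-∀
  lin′ {A} {B} {C} (suc i) x y A≗B A≗C eq = laplace-linear {A = A} {B} {C} x y λ j → begin
    A zero j * det n (minor A j)
      ≡⟨ cong (A zero j *_) (IH.lin i x y
           (λ k k≢i c → A≗B (suc k) (k≢i ∘ suc-injective) (punchIn j c))
           (λ k k≢i c → A≗C (suc k) (k≢i ∘ suc-injective) (punchIn j c))
           (λ c → eq (punchIn j c))) ⟩
    A zero j * (x * det n (minor B j) + y * det n (minor C j)) ≡⟨ distrib (A zero j) x y _ _ ⟩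
    x * (A zero j * det n (minor B j)) + y * (A zero j * det n (minor C j))
      ≡⟨ cong₂ (λ b c → x * (b * det n (minor B j)) + y * (c * det n (minor C j)))
           (A≗B zero (λ ()) j) (A≗C zero (λ ()) j) ⟩
    x * (B zero j * det n (minor B j)) + y * (C zero j * det n (minor C j)) ∎
    where
    open ≡-Reasoning
    distrib : ∀ a x y b c → a * (x * b + y * c) ≡ x * (a * b) + y * (a * c)
    distrib = solve-∀

  zero-row : ∀ n {A : Matrix (suc n) (suc n)} → (∀ j → det n (minor A j) ≡ + 0) → det (suc n) A ≡ + 0
  zero-row n {A} eq = trans (det-laplace n A) (sum-zero λ j →
    trans (cong (λ x → sgn (toℕ j) * (A zero j * x)) (eq j)) (lemma (sgn (toℕ j)) (A zero j)))
    where
    lemma : ∀ s a → s * (a * + 0) ≡ + 0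
    lemma = solve-∀

  -- Exchanging two rows below the first changes the sign of every minor, hence of the determinant.
  -- This brings the row that equals the first one to position 1, where `det-rows01` applies.
  alt0 : ∀ {n} → Alternating (det n) → ∀ {A : Matrix (suc n) (suc n)} k → A zero ≗ A (suc k) → det (suc n) A ≡ + 0
  alt0 {suc n} _   {A} zero A0≗Ak = det-rows01 n {A} A0≗Ak
  alt0 {suc n} det-alt {A} (suc k) A0≗Ak = begin
    -- The coefficients -1 and 0 reduce the two-term linearity to the single relation det A = - det
    -- A′.
    det (suc (suc n)) A ≡⟨ laplace-linear {A = A} {A′} {A′} (- + 1) (+ 0) (λ j →
        trans (cong (A zero j *_) (Alternating.swap det-alt {B = minor A j} zero (suc k) (λ ())
          (λ c → sym (A′-k+2 (punchIn j c))) (λ c → sym (A′-1 (punchIn j c)))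
          (λ l l≢0 l≢k c → sym (A′-off l l≢0 l≢k (punchIn j c)))))
        (lemma (A zero j) (det (suc n) (minor A′ j)))) ⟩
    - + 1 * det (suc (suc n)) A′ + + 0 * det (suc (suc n)) A′ ≡⟨ cong (λ x → - + 1 * x + + 0 * x) (det-rows01 n {A′} A′0≗A′1) ⟩
    + 0 ∎
    where
    open ≡-Reasoning
    B A′ : Matrix (suc (suc n)) (suc (suc n))
    B = setRow A (suc zero) (A (suc (suc k)))
    A′ = setRow B (suc (suc k)) (A (suc zero))
    lemma : ∀ a b → a * - b ≡ - + 1 * (a * b) + + 0 * (a * b)
    lemma = solve-∀
    ≡⇒≗ : {u v : Vector ℤ (suc (suc n))} → u ≡ v → u ≗ v
    ≡⇒≗ refl _ = refl
    A′-1 : A′ (suc zero) ≗ A (suc (suc k))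
    A′-1 = ≡⇒≗ (trans (setRow-off {A = B} {suc (suc k)} {A (suc zero)} {k = suc zero} (λ ())) (setRow-at {A = A} {suc zero} {A (suc (suc k))}))
    A′-k+2 : A′ (suc (suc k)) ≗ A (suc zero)
    A′-k+2 = ≡⇒≗ (setRow-at {A = B} {suc (suc k)} {A (suc zero)})
    A′-off : ∀ l → l ≢ zero → l ≢ suc k → A′ (suc l) ≗ A (suc l)
    A′-off l l≢0 l≢k = ≡⇒≗ (trans (setRow-off {A = B} {suc (suc k)} {A (suc zero)} {k = suc l} (l≢k ∘ suc-injective)) (setRow-off {A = A} {suc zero} {A (suc (suc k))} {k = suc l} (l≢0 ∘ suc-injective)))
    A′0≗A′1 : A′ zero ≗ A′ (suc zero)
    A′0≗A′1 c = trans (A0≗Ak c) (sym (A′-1 c))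

  alt′ : ∀ {A} i k → i ≢ k → A i ≗ A k → det (suc n) A ≡ + 0
  alt′ zero    zero    i≢k eq = ⊥-elim (i≢k refl)
  alt′ zero    (suc k) i≢k eq = alt0 (det-alternating n) k eq
  alt′ (suc i) zero    i≢k eq = alt0 (det-alternating n) i (sym ∘ eq)
  alt′ (suc i) (suc k) i≢k eq = zero-row n λ j → IH.alt i k (i≢k ∘ cong suc) (eq ∘ punchIn j)

-- Uniqueness of alternating functions

module _ {m n} {F : Matrix (suc m) n → ℤ} (F-alt : Alternating F) where
  open Alternating F-alt

  row-sum : ∀ {k} (a : Vector ℤ k) (v : Matrix k n) (T : Matrix m n) →
    F ((λ c → ∑[ j < k ] (a j * v j c)) ◂ T) ≡ ∑[ j < k ] (a j * F (v j ◂ T))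
  -- The empty combination is the zero row, read as 0 times a row plus 0 times a row.
  row-sum {zero}  a v T = lin {B = A} {A} zero (+ 0) (+ 0) (λ _ _ _ → refl) (λ _ _ _ → refl) (λ _ → refl)
    where
    A = (λ _ → + 0) ◂ T
  row-sum {suc k} a v T = begin
    F (_ ◂ T)
      ≡⟨ lin {B = v zero ◂ T} {R ◂ T} zero (a zero) (+ 1) off off (λ c → cong (λ z → a zero * v zero c + z) (sym (ℤ.*-identityˡ (R c)))) ⟩
    a zero * F (v zero ◂ T) + + 1 * F (R ◂ T)
      ≡⟨ cong (λ z → a zero * F (v zero ◂ T) + z) (trans (ℤ.*-identityˡ (F (R ◂ T))) (row-sum (a ∘ suc) (v ∘ suc) T)) ⟩
    a zero * F (v zero ◂ T) + ∑[ j < k ] (a (suc j) * F (v (suc j) ◂ T)) ∎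
    where
    open ≡-Reasoning
    R : Vector ℤ n
    R c = ∑[ j < k ] (a (suc j) * v (suc j) c)
    off : ∀ {u w : Vector ℤ n} l → l ≢ zero → (u ◂ T) l ≗ (w ◂ T) l
    off zero    l≢0 = ⊥-elim (l≢0 refl)
    off (suc l) l≢0 _ = refl

-- Passes from changing a single row to changing all of them. Rows are replaced from the top, and
-- the recursion absorbs the row already replaced into the function `G`.
rowwise : ∀ {m n} (P : Vector ℤ n → Vector ℤ n → Set) (G : Matrix m n → ℤ) →
  (∀ {A B} → (∀ i → A i ≗ B i) → G A ≡ G B) →
  (∀ A B i → (∀ k → k ≢ i → A k ≗ B k) → P (A i) (B i) → G A ≡ G B) →
  ∀ A B → (∀ i → P (A i) (B i)) → G A ≡ G B
rowwise {zero}  P G ext step A B PAB = ext (λ ())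
rowwise {suc m} P G ext step A B PAB = begin
  G A                ≡⟨ step A (B zero ◂ tail A) zero (λ { zero 0≢0 → ⊥-elim (0≢0 refl) ; (suc k) _ _ → refl }) (PAB zero) ⟩
  G (B zero ◂ tail A) ≡⟨ rowwise P (λ X → G (B zero ◂ X)) (λ eq → ext λ { zero _ → refl ; (suc k) → eq k })
      (λ X Y i eq p → step (B zero ◂ X) (B zero ◂ Y) (suc i)
        (λ { zero _ _ → refl ; (suc k) k≢i → eq k (k≢i ∘ cong suc) }) p)
      (tail A) (tail B) (PAB ∘ suc) ⟩
  G (B zero ◂ tail B) ≡⟨ ext (λ { zero _ → refl ; (suc k) _ → refl }) ⟩
  G B ∎
  where open ≡-Reasoning

punchIn-elim : ∀ {n} (j : Fin (suc n)) (Q : Fin (suc n) → Set) → Q j → (∀ k → Q (punchIn j k)) → ∀ c → Q c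
punchIn-elim j Q Qj Qk c with j ≟F c
... | yes refl = Qj
... | no j≢c   = subst Q (punchIn-punchOut j≢c) (Qk (punchOut j≢c))

δ-sym : ∀ {m n} (i : Fin m) (j : Fin n) → δ i j ≡ δ j i
δ-sym zero    zero    = refl
δ-sym zero    (suc j) = refl
δ-sym (suc i) zero    = refl
δ-sym (suc i) (suc j) = δ-sym i j

δ-punchIn : ∀ {n} (j : Fin (suc n)) (i k : Fin n) → δ (punchIn j i) (punchIn j k) ≡ δ i k
δ-punchIn zero    i       k       = refl
δ-punchIn (suc j) zero    zero    = refl
δ-punchIn (suc j) zero    (suc k) = refl
δ-punchIn (suc j) (suc i) zero    = refl
δ-punchIn (suc j) (suc i) (suc k) = δ-punchIn j i k

punchIn-inject₁ : ∀ {n} (j : Fin n) → punchIn (inject₁ j) j ≡ suc j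
punchIn-inject₁ zero    = refl
punchIn-inject₁ (suc j) = cong suc (punchIn-inject₁ j)

punchIn-suc : ∀ {n} (j : Fin n) → punchIn (suc j) j ≡ inject₁ j
punchIn-suc zero    = refl
punchIn-suc (suc j) = cong suc (punchIn-suc j)

punchIn-adjacent : ∀ {n} {j l : Fin n} → l ≢ j → punchIn (suc j) l ≡ punchIn (inject₁ j) l
punchIn-adjacent {j = zero}  {zero}  l≢j = ⊥-elim (l≢j refl)
punchIn-adjacent {j = zero}  {suc l} l≢j = refl
punchIn-adjacent {j = suc j} {zero}  l≢j = refl
punchIn-adjacent {j = suc j} {suc l} l≢j = cong suc (punchIn-adjacent (l≢j ∘ cong suc))

sum-*δ : ∀ {n} (v : Vector ℤ n) (c : Fin n) → ∑[ j < n ] (v j * δ j c) ≡ v c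
sum-*δ v c = trans (sum-cong-≗ λ j → trans (ℤ.*-comm (v j) (δ j c)) (cong (_* v j) (δ-sym j c))) (sum-δ c v)

insertZero : ∀ {n} → Fin (suc n) → Vector ℤ n → Vector ℤ (suc n)
insertZero j v = insertAt v j (+ 0)

module _ {n} {F : Matrix (suc n) (suc n) → ℤ} (F-alt : Alternating F) where
  open Alternating F-alt
  open ≡-Reasoning

  -- These are the rows of `δ` with row j moved to the top. Going from j to j + 1 exchanges the top
  -- row with the one in position j + 1, so each step contributes one sign.
  alternating-δ-cycle : ∀ j → F (δ j ◂ λ i → δ (punchIn j i)) ≡ sgn (toℕ j) * F δ
  alternating-δ-cycle = <-weakInduction _ base step
    where
    cycle : Fin (suc n) → Matrix (suc n) (suc n)
    cycle j = δ j ◂ λ i → δ (punchIn j i)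
    base : F (cycle zero) ≡ + 1 * F δ
    base = trans (ext λ { zero _ → refl ; (suc i) _ → refl }) (sym (ℤ.*-identityˡ (F δ)))
    ≡⇒≗ : {i j : Fin (suc n)} → i ≡ j → δ {suc n} {suc n} i ≗ δ j
    ≡⇒≗ refl _ = refl
    step : ∀ j → F (cycle (inject₁ j)) ≡ sgn (toℕ (inject₁ j)) * F δ → F (cycle (suc j)) ≡ - sgn (toℕ j) * F δ
    step j IH = begin
      F (cycle (suc j))               ≡⟨ swap zero (suc j) (λ ()) (≡⇒≗ (sym (punchIn-inject₁ j))) (≡⇒≗ (punchIn-suc j)) off ⟩
      - F (cycle (inject₁ j))         ≡⟨ cong -_ IH ⟩
      - (sgn (toℕ (inject₁ j)) * F δ) ≡⟨ cong (λ k → - (sgn k * F δ)) (toℕ-inject₁ j) ⟩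
      - (sgn (toℕ j) * F δ)           ≡⟨ ℤ.neg-distribˡ-* (sgn (toℕ j)) (F δ) ⟩
      - sgn (toℕ j) * F δ             ∎
      where
      off : ∀ l → l ≢ zero → l ≢ suc j → cycle (suc j) l ≗ cycle (inject₁ j) l
      off zero    l≢0 _   = ⊥-elim (l≢0 refl)
      off (suc l) _   l≢j = ≡⇒≗ (punchIn-adjacent (l≢j ∘ cong suc))

  -- Row operations with the first row δ j clear column j.
  clear-column : ∀ j (T : Matrix n (suc n)) → F (δ j ◂ T) ≡ F (δ j ◂ λ i → insertZero j (T i ∘ punchIn j))
  clear-column j T = rowwise P (λ X → F (δ j ◂ X)) (λ eq → ext λ { zero _ → refl ; (suc i) → eq i }) step T _ P-T
    where
    P : Vector ℤ (suc n) → Vector ℤ (suc n) → Set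
    P u w = ∃ λ t → ∀ c → u c ≡ w c + t * δ j c
    step : ∀ X Y i → (∀ k → k ≢ i → X k ≗ Y k) → P (X i) (Y i) → F (δ j ◂ X) ≡ F (δ j ◂ Y)
    step X Y i X≗Y (t , eq) = begin
      F (δ j ◂ X)                     ≡⟨ lin {B = δ j ◂ Y} {δ j ◂ Z} (suc i) (+ 1) t
          (λ { zero _ _ → refl ; (suc k) k≢i → X≗Y k (k≢i ∘ cong suc) })
          (λ { zero _ _ → refl ; (suc k) k≢i c → trans (X≗Y k (k≢i ∘ cong suc) c)
                 (cong (λ r → r c) (sym (setRow-off {A = Y} {i} {δ j} (k≢i ∘ cong suc)))) })
          (λ c → trans (eq c) (cong₂ _+_ (sym (ℤ.*-identityˡ (Y i c)))
                 (cong (λ r → t * r c) (sym (setRow-at {A = Y} {i} {δ j}))))) ⟩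
      + 1 * F (δ j ◂ Y) + t * F (δ j ◂ Z) ≡⟨ cong₂ (λ a b → a + t * b) (ℤ.*-identityˡ (F (δ j ◂ Y)))
          (alt zero (suc i) (λ ()) λ c → cong (λ r → r c) (sym (setRow-at {A = Y} {i} {δ j}))) ⟩
      F (δ j ◂ Y) + t * + 0           ≡⟨ cong (λ z → F (δ j ◂ Y) + z) (ℤ.*-zeroʳ t) ⟩
      F (δ j ◂ Y) + + 0               ≡⟨ ℤ.+-identityʳ (F (δ j ◂ Y)) ⟩
      F (δ j ◂ Y)                     ∎
      where
      Z = setRow Y i (δ j)
    P-T : ∀ i → P (T i) (insertZero j (T i ∘ punchIn j))
    P-T i = T i j , punchIn-elim j (λ c → T i c ≡ insertZero j (T i ∘ punchIn j) c + T i j * δ j c)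
      (sym (begin
        insertZero j (T i ∘ punchIn j) j + T i j * δ j j ≡⟨ cong₂ (λ a b → a + T i j * b) (insertAt-lookup (T i ∘ punchIn j) j (+ 0)) (δ-refl j) ⟩
        + 0 + T i j * + 1 ≡⟨ trans (ℤ.+-identityˡ _) (ℤ.*-identityʳ (T i j)) ⟩
        T i j ∎))
      (λ k → sym (begin
        insertZero j (T i ∘ punchIn j) (punchIn j k) + T i j * δ j (punchIn j k)
          ≡⟨ cong₂ (λ a b → a + T i j * b) (insertAt-punchIn (T i ∘ punchIn j) j (+ 0) k) (δ-≢ (punchInᵢ≢i j k ∘ sym)) ⟩
        T i (punchIn j k) + T i j * + 0 ≡⟨ cong (λ z → T i (punchIn j k) + z) (ℤ.*-zeroʳ (T i j)) ⟩
        T i (punchIn j k) + + 0 ≡⟨ ℤ.+-identityʳ _ ⟩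
        T i (punchIn j k) ∎))

  -- F on matrices with top row `δ j` and zeros below it in column j, seen as a function of the
  -- complementary minor. It is again alternating, and the induction for uniqueness is applied to
  -- it.
  restrict : Fin (suc n) → Matrix n n → ℤ
  restrict j X = F (δ j ◂ (insertZero j ∘ X))

  restrict-alternating : ∀ j → Alternating (restrict j)
  restrict-alternating j = record
    { ext = λ eq → ext λ { zero _ → refl ; (suc i) → insert-cong (eq i) }
    ; lin = λ {A} {B} {C} i x y A≗B A≗C eq → lin (suc i) x y
        (λ { zero _ _ → refl ; (suc k) k≢i → insert-cong (A≗B k (k≢i ∘ cong suc)) })
        (λ { zero _ _ → refl ; (suc k) k≢i → insert-cong (A≗C k (k≢i ∘ cong suc)) })
        (insert-linear (A i) (B i) (C i) x y eq)
    ; alt = λ i k i≢k eq → alt (suc i) (suc k) (i≢k ∘ suc-injective) (insert-cong eq)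
    }
    where
    insert-linear : ∀ u v w x y → (∀ c → u c ≡ x * v c + y * w c) →
      ∀ c → insertZero j u c ≡ x * insertZero j v c + y * insertZero j w c
    insert-linear u v w x y eq = punchIn-elim j _
      (begin
        insertZero j u j ≡⟨ insertAt-lookup u j (+ 0) ⟩
        + 0              ≡⟨ lemma x y ⟩
        x * + 0 + y * + 0 ≡⟨ cong₂ (λ a b → x * a + y * b) (insertAt-lookup v j (+ 0)) (insertAt-lookup w j (+ 0)) ⟨
        x * insertZero j v j + y * insertZero j w j ∎)
      (λ k → begin
        insertZero j u (punchIn j k) ≡⟨ insertAt-punchIn u j (+ 0) k ⟩
        u k                          ≡⟨ eq k ⟩
        x * v k + y * w k ≡⟨ cong₂ (λ a b → x * a + y * b) (insertAt-punchIn v j (+ 0) k) (insertAt-punchIn w j (+ 0) k) ⟨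
        x * insertZero j v (punchIn j k) + y * insertZero j w (punchIn j k) ∎)
      where
      lemma : ∀ x y → + 0 ≡ x * + 0 + y * + 0
      lemma = solve-∀
    insert-cong : ∀ {u v} → u ≗ v → insertZero j u ≗ insertZero j v
    insert-cong {u} {v} eq = punchIn-elim j _
      (trans (insertAt-lookup u j (+ 0)) (sym (insertAt-lookup v j (+ 0))))
      (λ k → trans (insertAt-punchIn u j (+ 0) k) (trans (eq k) (sym (insertAt-punchIn v j (+ 0) k))))

  restrict-δ : ∀ j → restrict j δ ≡ sgn (toℕ j) * F δ
  restrict-δ j = trans (ext λ { zero _ → refl ; (suc i) → row i }) (alternating-δ-cycle j)
    where
    row : ∀ i → insertZero j (δ i) ≗ δ (punchIn j i)
    row i = punchIn-elim j _
      (trans (insertAt-lookup (δ i) j (+ 0)) (sym (δ-≢ (punchInᵢ≢i j i))))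
      (λ k → trans (insertAt-punchIn (δ i) j (+ 0) k) (sym (δ-punchIn j i k)))

-- Write the first row as a combination of unit vectors `δ j`, clear column j below each, and use
-- the induction hypothesis on the remaining block: the result is the Laplace expansion, term by
-- term, times F at the identity.
alternating-unique : ∀ n {F : Matrix n n → ℤ} → Alternating F → ∀ A → F A ≡ det n A * F δ
alternating-unique zero    {F} F-alt A = trans (Alternating.ext F-alt (λ ())) (sym (ℤ.*-identityˡ (F δ)))
alternating-unique (suc n) {F} F-alt A = begin
  F A                                                       ≡⟨ ext (λ { zero c → sym (sum-*δ (A zero) c) ; (suc i) _ → refl }) ⟩
  F ((λ c → ∑[ j < suc n ] (A zero j * δ j c)) ◂ tail A)    ≡⟨ row-sum F-alt (A zero) δ (tail A) ⟩
  ∑[ j < suc n ] (A zero j * F (δ j ◂ tail A))              ≡⟨ sum-cong-≗ (λ j → trans (cong (A zero j *_) (expand j)) (lemma (A zero j) (det n (minor A j)) (sgn (toℕ j)) (F δ))) ⟩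
  ∑[ j < suc n ] (sgn (toℕ j) * (A zero j * det n (minor A j)) * F δ) ≡⟨ *-distribʳ-sum (F δ) (λ j → sgn (toℕ j) * (A zero j * det n (minor A j))) ⟨
  (∑[ j < suc n ] (sgn (toℕ j) * (A zero j * det n (minor A j)))) * F δ ≡⟨ cong (_* F δ) (det-laplace n A) ⟨
  det (suc n) A * F δ                                       ∎
  where
  open Alternating F-alt
  open ≡-Reasoning
  expand : ∀ j → F (δ j ◂ tail A) ≡ det n (minor A j) * (sgn (toℕ j) * F δ)
  expand j = begin
    F (δ j ◂ tail A)                    ≡⟨ clear-column F-alt j (tail A) ⟩
    restrict F-alt j (minor A j)        ≡⟨ alternating-unique n (restrict-alternating F-alt j) (minor A j) ⟩
    det n (minor A j) * restrict F-alt j δ ≡⟨ cong (det n (minor A j) *_) (restrict-δ F-alt j) ⟩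
    det n (minor A j) * (sgn (toℕ j) * F δ) ∎
  lemma : ∀ a d s f → a * (d * (s * f)) ≡ s * (a * d) * f
  lemma = solve-∀

-- Multiplicativity of the determinant

infixl 7 _⊗_
_⊗_ : ∀ {l m n} → Matrix l m → Matrix m n → Matrix l n
_⊗_ {m = m} A B i k = ∑[ j < m ] (A i j * B j k)

-- Uniqueness is applied with B fixed: row i of a product depends only on row i of the left factor,
-- and linearly.
det-⊗ : ∀ n (A B : Matrix n n) → det n (A ⊗ B) ≡ det n A * det n B
det-⊗ n A B = trans (alternating-unique n rows-alternating A)
  (cong (det n A *_) (det-cong n λ i k → sum-δ i (λ j → B j k)))
  where
  open Alternating (det-alternating n)
  row-cong : ∀ {u v : Vector ℤ n} → u ≗ v → ∀ k → ∑[ j < n ] (u j * B j k) ≡ ∑[ j < n ] (v j * B j k)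
  row-cong eq k = sum-cong-≗ λ j → cong (_* B j k) (eq j)
  rows-alternating : Alternating (λ X → det n (X ⊗ B))
  rows-alternating = record
    { ext = λ eq → ext λ i → row-cong (eq i)
    ; lin = λ {X} {Y} {Z} i x y X≗Y X≗Z eq → lin i x y
        (λ k k≢i → row-cong (X≗Y k k≢i)) (λ k k≢i → row-cong (X≗Z k k≢i))
        (λ k → sum-linear x y λ j → trans (cong (_* B j k) (eq j)) (distrib x y (Y i j) (Z i j) (B j k)))
    ; alt = λ i k i≢k eq → alt i k i≢k (row-cong eq)
    }
    where
    distrib : ∀ x y b c d → (x * b + y * c) * d ≡ x * (b * d) + y * (c * d)
    distrib = solve-∀

-- Arithmetic and norm in the quotient ring

module QuotientRing {m : ℕ} (c : Vector ℤ (suc m)) where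
  open ≡-Reasoning

  U : Vector ℤ (suc m) → Vector ℤ (suc m)
  U = mulU c

  -- The product of the class of a polynomial with a ring element. `image` is the case where that
  -- element is 1; allowing any element makes composition express multiplication of polynomials, so
  -- no product of coordinate vectors has to be defined.
  act : List ℤ → Vector ℤ (suc m) → Vector ℤ (suc m)
  act []       w i = + 0
  act (a ∷ as) w i = a * w i + U (act as w) i

  𝟙 : Vector ℤ (suc m)
  𝟙 = δ {suc m} zero

  U-linear : ∀ x v w → U (λ i → x * v i + w i) ≗ λ i → x * U v i + U w i
  U-linear x v w zero = lemma x (c zero) (v (fromℕ m)) (w (fromℕ m))
    where
    lemma : ∀ x c v w → - (c * (x * v + w)) ≡ x * - (c * v) + - (c * w)
    lemma = solve-∀
  U-linear x v w (suc j) = lemma x (c (suc j)) (v (inject₁ j)) (w (inject₁ j)) (v (fromℕ m)) (w (fromℕ m))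
    where
    lemma : ∀ x c v w v′ w′ → (x * v + w) - c * (x * v′ + w′) ≡ x * (v - c * v′) + (w - c * w′)
    lemma = solve-∀

  U-zero : U (λ _ → + 0) ≗ λ _ → + 0
  U-zero zero    = cong -_ (ℤ.*-zeroʳ (c zero))
  U-zero (suc j) = cong (λ x → + 0 - x) (ℤ.*-zeroʳ (c (suc j)))

  module _ {_~_ : ℤ → ℤ → Set} (~-cong : IsCongruence _~_) where
    open IsCongruence ~-cong

    U-~ : ∀ {v w} → (∀ i → v i ~ w i) → ∀ i → U v i ~ U w i
    U-~ v~w zero    = neg-~ (*-~ (~-refl {c zero}) (v~w (fromℕ m)))
    U-~ v~w (suc j) = +-~ (v~w (inject₁ j)) (neg-~ (*-~ (~-refl {c (suc j)}) (v~w (fromℕ m))))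

    act-~ : ∀ f {v w} → (∀ i → v i ~ w i) → ∀ i → act f v i ~ act f w i
    act-~ []       v~w i = ~-refl
    act-~ (a ∷ as) v~w i = +-~ (*-~ (~-refl {a}) (v~w i)) (U-~ (act-~ as v~w) i)

    act-coeff : ∀ f g → (∀ k → PZ.coeff f k ~ PZ.coeff g k) → ∀ w i → act f w i ~ act g w i
    act-coeff []       []       f~g w i = ~-refl
    -- The lists may differ in length: the missing tail counts as zeros, and the recursion goes on
    -- against `[]`.
    act-coeff []       (b ∷ bs) f~g w i = subst (_~ (b * w i + U (act bs w) i)) (cong (λ x → + 0 * w i + x) (U-zero i))
      (+-~ (*-~ (f~g 0) (~-refl {w i})) (U-~ (act-coeff [] bs (f~g ∘ suc) w) i))
    act-coeff (a ∷ as) []       f~g w i = subst ((a * w i + U (act as w) i) ~_) (cong (λ x → + 0 * w i + x) (U-zero i))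
      (+-~ (*-~ (f~g 0) (~-refl {w i})) (U-~ (act-coeff as [] (f~g ∘ suc) w) i))
    act-coeff (a ∷ as) (b ∷ bs) f~g w i =
      +-~ (*-~ (f~g 0) (~-refl {w i})) (U-~ (act-coeff as bs (f~g ∘ suc) w) i)

  U-cong : ∀ {v w} → v ≗ w → U v ≗ U w
  U-cong = U-~ ≡-isCongruence

  act-cong : ∀ f {v w} → v ≗ w → act f v ≗ act f w
  act-cong = act-~ ≡-isCongruence

  act-zero : ∀ f → act f (λ _ → + 0) ≗ λ _ → + 0
  act-zero []       i = refl
  act-zero (a ∷ as) i = cong₂ _+_ (ℤ.*-zeroʳ a) (trans (U-cong (act-zero as) i) (U-zero i))

  act-linear : ∀ f x v w → act f (λ i → x * v i + w i) ≗ λ i → x * act f v i + act f w i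
  act-linear []       x v w i = sym (trans (ℤ.+-identityʳ (x * + 0)) (ℤ.*-zeroʳ x))
  act-linear (a ∷ as) x v w i = begin
    a * (x * v i + w i) + U (act as (λ i → x * v i + w i)) i
      ≡⟨ cong (λ z → a * (x * v i + w i) + z) (trans (U-cong (act-linear as x v w) i) (U-linear x (act as v) (act as w) i)) ⟩
    a * (x * v i + w i) + (x * U (act as v) i + U (act as w) i) ≡⟨ lemma a x (v i) (w i) _ _ ⟩
    x * (a * v i + U (act as v) i) + (a * w i + U (act as w) i) ∎
    where
    lemma : ∀ a x v w v′ w′ → a * (x * v + w) + (x * v′ + w′) ≡ x * (a * v + v′) + (a * w + w′)
    lemma = solve-∀

  act-U : ∀ f w → act f (U w) ≗ U (act f w)
  act-U []       w i = sym (U-zero i)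
  act-U (a ∷ as) w i = begin
    a * U w i + U (act as (U w)) i      ≡⟨ cong (λ z → a * U w i + z) (U-cong (act-U as w) i) ⟩
    a * U w i + U (U (act as w)) i      ≡⟨ U-linear a w (U (act as w)) i ⟨
    U (λ i → a * w i + U (act as w) i) i ∎

  act-comm : ∀ f g w → act f (act g w) ≗ act g (act f w)
  act-comm f []       w i = act-zero f i
  act-comm f (b ∷ bs) w i = begin
    act f (λ i → b * w i + U (act bs w) i) i     ≡⟨ act-linear f b w (U (act bs w)) i ⟩
    b * act f w i + act f (U (act bs w)) i       ≡⟨ cong (λ z → b * act f w i + z) (act-U f (act bs w) i) ⟩
    b * act f w i + U (act f (act bs w)) i       ≡⟨ cong (λ z → b * act f w i + z) (U-cong (act-comm f bs w) i) ⟩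
    b * act f w i + U (act bs (act f w)) i       ∎

  act-addP : ∀ f g w i → act (PZ.addP f g) w i ≡ act f w i + act g w i
  act-addP []       g        w i = sym (ℤ.+-identityˡ (act g w i))
  act-addP (a ∷ as) []       w i = sym (ℤ.+-identityʳ (act (a ∷ as) w i))
  act-addP (a ∷ as) (b ∷ bs) w i = begin
    (a + b) * w i + U (act (PZ.addP as bs) w) i
      ≡⟨ cong (λ z → (a + b) * w i + z) (trans (U-cong eq i) (U-linear (+ 1) (act as w) (act bs w) i)) ⟩
    (a + b) * w i + (+ 1 * U (act as w) i + U (act bs w) i) ≡⟨ lemma a b (w i) _ _ ⟩
    (a * w i + U (act as w) i) + (b * w i + U (act bs w) i) ∎
    where
    eq : ∀ i → act (PZ.addP as bs) w i ≡ + 1 * act as w i + act bs w i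
    eq i = trans (act-addP as bs w i) (cong (_+ act bs w i) (sym (ℤ.*-identityˡ (act as w i))))
    lemma : ∀ a b w x y → (a + b) * w + (+ 1 * x + y) ≡ (a * w + x) + (b * w + y)
    lemma = solve-∀

  act-scale : ∀ a g w i → act (map (a *_) g) w i ≡ a * act g w i
  act-scale a []       w i = sym (ℤ.*-zeroʳ a)
  act-scale a (b ∷ bs) w i = begin
    a * b * w i + U (act (map (a *_) bs) w) i ≡⟨ cong (λ z → a * b * w i + z) (trans (U-cong eq i) (U-linear a (act bs w) (λ _ → + 0) i)) ⟩
    a * b * w i + (a * U (act bs w) i + U (λ _ → + 0) i) ≡⟨ cong (λ z → a * b * w i + (a * U (act bs w) i + z)) (U-zero i) ⟩
    a * b * w i + (a * U (act bs w) i + + 0)  ≡⟨ lemma a b (w i) (U (act bs w) i) ⟩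
    a * (b * w i + U (act bs w) i)            ∎
    where
    eq : ∀ i → act (map (a *_) bs) w i ≡ a * act bs w i + + 0
    eq i = trans (act-scale a bs w i) (sym (ℤ.+-identityʳ (a * act bs w i)))
    lemma : ∀ a b w x → a * b * w + (a * x + + 0) ≡ a * (b * w + x)
    lemma = solve-∀

  act-mulP : ∀ f g w → act (PZ.mulP f g) w ≗ act f (act g w)
  act-mulP []       g w i = refl
  act-mulP (a ∷ as) g w i = begin
    act (PZ.addP (map (a *_) g) (+ 0 ∷ PZ.mulP as g)) w i ≡⟨ act-addP (map (a *_) g) (+ 0 ∷ PZ.mulP as g) w i ⟩
    act (map (a *_) g) w i + (+ 0 * w i + U (act (PZ.mulP as g) w) i)
      ≡⟨ cong₂ _+_ (act-scale a g w i) (trans (ℤ.+-identityˡ (U (act (PZ.mulP as g) w) i)) (U-cong (act-mulP as g w) i)) ⟩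
    a * act g w i + U (act as (act g w)) i                ∎

  U^ : ℕ → Vector ℤ (suc m) → Vector ℤ (suc m)
  U^ zero    w = w
  U^ (suc k) w = U (U^ k w)

  U^-U : ∀ k w → U^ k (U w) ≗ U (U^ k w)
  U^-U zero    w i = refl
  U^-U (suc k) w i = U-cong (U^-U k w) i

  -- Used with g = 1 for monic polynomials and with g empty for coordinate vectors.
  act-toList-++ : ∀ {k} (v : Vector ℤ k) g w i → act (toList v ++ g) w i ≡ ∑[ j < k ] (v j * U^ (toℕ j) w i) + act g (U^ k w) i
  act-toList-++ {zero}  v g w i = sym (ℤ.+-identityˡ (act g w i))
  act-toList-++ {suc k} v g w i = begin
    v zero * w i + U (act h w) i ≡⟨ cong (λ z → v zero * w i + z) (act-U h w i) ⟨
    v zero * w i + act h (U w) i ≡⟨ cong (λ z → v zero * w i + z) (act-toList-++ (v ∘ suc) g (U w) i) ⟩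
    v zero * w i + (∑[ j < k ] (v (suc j) * U^ (toℕ j) (U w) i) + act g (U^ k (U w)) i)
      ≡⟨ cong₂ (λ y z → v zero * w i + (y + z)) (sum-cong-≗ λ j → cong (v (suc j) *_) (U^-U (toℕ j) w i)) (act-cong g (U^-U k w) i) ⟩
    v zero * w i + (∑[ j < k ] (v (suc j) * U (U^ (toℕ j) w) i) + act g (U (U^ k w)) i)
      ≡⟨ ℤ.+-assoc (v zero * w i) _ _ ⟨
    v zero * w i + ∑[ j < k ] (v (suc j) * U (U^ (toℕ j) w) i) + act g (U (U^ k w)) i ∎
    where
    h = toList (v ∘ suc) ++ g

  U^-δ : ∀ j → U^ (toℕ j) 𝟙 ≗ δ j
  U^-δ = <-weakInduction _ (λ _ → refl) step
    where
    U-δ : ∀ j → U (δ (inject₁ j)) ≗ δ (suc j)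
    U-δ j zero    = trans (cong (λ z → - (c zero * z)) (δ-≢ {i = inject₁ j} {fromℕ m} (fromℕ≢inject₁ {i = j} ∘ sym))) (cong -_ (ℤ.*-zeroʳ (c zero)))
    U-δ j (suc i) = trans (cong₂ (λ y z → y - c (suc i) * z) (δ-inject₁ j i) (δ-≢ {i = inject₁ j} {fromℕ m} (fromℕ≢inject₁ {i = j} ∘ sym)))
      (lemma (δ j i) (c (suc i)))
      where
      lemma : ∀ a c → a - c * + 0 ≡ a
      lemma = solve-∀
      δ-inject₁ : ∀ {n} (i j : Fin n) → δ (inject₁ i) (inject₁ j) ≡ δ i j
      δ-inject₁ zero    zero    = refl
      δ-inject₁ zero    (suc j) = refl
      δ-inject₁ (suc i) zero    = refl
      δ-inject₁ (suc i) (suc j) = δ-inject₁ i j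
    step : ∀ j → U^ (toℕ (inject₁ j)) 𝟙 ≗ δ (inject₁ j) → U^ (suc (toℕ j)) 𝟙 ≗ δ (suc j)
    step j IH i = trans (U-cong (λ i′ → trans (cong (λ k → U^ k 𝟙 i′) (sym (toℕ-inject₁ j))) (IH i′)) i) (U-δ j i)

  U^-δ-last : ∀ i → U^ (suc m) 𝟙 i ≡ - c i
  U^-δ-last i = trans (U-cong (λ i′ → trans (cong (λ k → U^ k 𝟙 i′) (sym (toℕ-fromℕ m))) (U^-δ (fromℕ m) i′)) i) (U-δ i)
    where
    U-δ : ∀ i → U (δ (fromℕ m)) i ≡ - c i
    U-δ zero    = trans (cong (λ z → - (c zero * z)) (δ-refl (fromℕ m))) (cong -_ (ℤ.*-identityʳ (c zero)))
    U-δ (suc i) = trans (cong₂ (λ y z → y - c (suc i) * z) (δ-≢ {i = fromℕ m} {inject₁ i} (fromℕ≢inject₁ {i = i})) (δ-refl (fromℕ m)))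
      (lemma (c (suc i)))
      where
      lemma : ∀ c → + 0 - c * + 1 ≡ - c
      lemma = solve-∀

  sum-U^-δ : ∀ (v : Vector ℤ (suc m)) i → ∑[ j < suc m ] (v j * U^ (toℕ j) 𝟙 i) ≡ v i
  sum-U^-δ v i = trans (sum-cong-≗ λ j → cong (v j *_) (U^-δ j i)) (sum-*δ v i)

  act-toList-δ : ∀ v → act (toList v) 𝟙 ≗ v
  act-toList-δ v i = begin
    act (toList v) 𝟙 i       ≡⟨ cong (λ f → act f 𝟙 i) (++-identityʳ (toList v)) ⟨
    act (toList v ++ []) 𝟙 i ≡⟨ act-toList-++ v [] 𝟙 i ⟩
    ∑[ j < suc m ] (v j * U^ (toℕ j) 𝟙 i) + + 0 ≡⟨ ℤ.+-identityʳ _ ⟩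
    ∑[ j < suc m ] (v j * U^ (toℕ j) 𝟙 i) ≡⟨ sum-U^-δ v i ⟩
    v i ∎

  -- Every w is a polynomial in u applied to 1, and polynomials in u commute, so it is enough that
  -- q(u) kills 1; there the relation for the leading power cancels the lower terms.
  act-monic : ∀ w → act (monicList c) w ≗ λ _ → + 0
  act-monic w i = begin
    act q w i                            ≡⟨ act-cong q (act-toList-δ w) i ⟨
    act q (act (toList w) 𝟙) i    ≡⟨ act-comm q (toList w) 𝟙 i ⟩
    act (toList w) (act q 𝟙) i    ≡⟨ act-cong (toList w) act-δ i ⟩
    act (toList w) (λ _ → + 0) i         ≡⟨ act-zero (toList w) i ⟩
    + 0 ∎
    where
    q = monicList c
    act-δ : act q 𝟙 ≗ λ _ → + 0
    act-δ i = begin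
      act q 𝟙 i ≡⟨ act-toList-++ c (+ 1 ∷ []) 𝟙 i ⟩
      ∑[ j < suc m ] (c j * U^ (toℕ j) 𝟙 i) + (+ 1 * U^ (suc m) 𝟙 i + U (λ _ → + 0) i)
        ≡⟨ cong₂ _+_ (sum-U^-δ c i) (cong₂ (λ y z → + 1 * y + z) (U^-δ-last i) (U-zero i)) ⟩
      c i + (+ 1 * - c i + + 0) ≡⟨ lemma (c i) ⟩
      + 0 ∎
      where
      lemma : ∀ c → c + (+ 1 * - c + + 0) ≡ + 0
      lemma = solve-∀

  act-sum : ∀ f {k} (v : Vector ℤ k) (W : Matrix k (suc m)) i →
    act f (λ i → ∑[ j < k ] (v j * W j i)) i ≡ ∑[ j < k ] (v j * act f (W j) i)
  act-sum f {zero}  v W i = act-zero f i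
  act-sum f {suc k} v W i = trans (act-linear f (v zero) (W zero) (λ i → ∑[ j < k ] (v (suc j) * W (suc j) i)) i)
    (cong (λ z → v zero * act f (W zero) i + z) (act-sum f (v ∘ suc) (W ∘ suc) i))

  mulMatrix : List ℤ → Matrix (suc m) (suc m)
  mulMatrix f i j = act f (δ j) i

  norm : List ℤ → ℤ
  norm f = det (suc m) (mulMatrix f)

  norm-mulP : ∀ f g → norm (PZ.mulP f g) ≡ norm f * norm g
  norm-mulP f g = trans (det-cong (suc m) entry) (det-⊗ (suc m) (mulMatrix f) (mulMatrix g))
    where
    entry : ∀ i k → act (PZ.mulP f g) (δ k) i ≡ ∑[ j < suc m ] (act f (δ j) i * act g (δ k) j)
    entry i k = begin
      act (PZ.mulP f g) (δ k) i ≡⟨ act-mulP f g (δ k) i ⟩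
      act f v i                 ≡⟨ act-cong f (sum-*δ v) i ⟨
      act f (λ i → ∑[ j < suc m ] (v j * δ j i)) i ≡⟨ act-sum f v δ i ⟩
      ∑[ j < suc m ] (v j * act f (δ j) i) ≡⟨ sum-cong-≗ (λ j → ℤ.*-comm (v j) (act f (δ j) i)) ⟩
      ∑[ j < suc m ] (act f (δ j) i * v j) ∎
      where
      v = act g (δ k)

  norm-~ : ∀ {_~_} → IsCongruence _~_ → ∀ f g → (∀ k → PZ.coeff f k ~ PZ.coeff g k) → norm f ~ norm g
  norm-~ ~-cong f g f~g = IsCongruence.det-~ ~-cong (suc m) λ i j → act-coeff ~-cong f g f~g (δ j) i

  image-act : ∀ f → image c f ≗ act f 𝟙
  image-act []       zero    = refl
  image-act []       (suc i) = refl
  image-act (a ∷ as) i = cong₂ _+_ (const-δ a i) (U-cong (image-act as) i)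
    where
    const-δ : ∀ a (i : Fin (suc m)) → constQ a i ≡ a * δ {suc m} zero i
    const-δ a zero    = sym (ℤ.*-identityʳ a)
    const-δ a (suc i) = sym (ℤ.*-zeroʳ a)

  -- The shift by j zeros is multiplication by the j-th power of u; moved to the argument it turns 1
  -- into the j-th basis vector.
  D-norm : ∀ xs → D c xs ≡ norm (toList xs)
  D-norm xs = det-cong (suc m) λ i j → begin
    image c (replicate (toℕ j) (+ 0) ++ toList xs) i ≡⟨ image-act (replicate (toℕ j) (+ 0) ++ toList xs) i ⟩
    act (replicate (toℕ j) (+ 0) ++ toList xs) 𝟙 i ≡⟨ act-replicate (toℕ j) (toList xs) 𝟙 i ⟩
    act (toList xs) (U^ (toℕ j) 𝟙) i ≡⟨ act-cong (toList xs) (U^-δ j) i ⟩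
    act (toList xs) (δ j) i ∎
    where
    act-replicate : ∀ k f w i → act (replicate k (+ 0) ++ f) w i ≡ act f (U^ k w) i
    act-replicate zero    f w i = refl
    act-replicate (suc k) f w i = begin
      + 0 + U (act (replicate k (+ 0) ++ f) w) i ≡⟨ ℤ.+-identityˡ _ ⟩
      U (act (replicate k (+ 0) ++ f) w) i       ≡⟨ U-cong (act-replicate k f w) i ⟩
      U (act f (U^ k w)) i                       ≡⟨ act-U f (U^ k w) i ⟨
      act f (U (U^ k w)) i                       ∎

-- Congruence modulo m and divisibility of determinants

infix 4 _≈_[_]
-- A record keeps x, y and m visible in the type, so that the implicit arguments of `IsCongruence`
-- can be inferred.
record _≈_[_] (x y : ℤ) (m : ℕ) : Set where
  constructor congruent
  field ∣-difference : + m ∣ˢ x - y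
open _≈_[_] using (∣-difference)

∣0 : ∀ {k} → k ∣ˢ + 0
∣0 = divides (+ 0) refl

module _ {m : ℕ} where
  ≡⇒≈ : ∀ {x y} → x ≡ y → x ≈ y [ m ]
  ≡⇒≈ {x} refl = congruent (subst (+ m ∣ˢ_) (sym (ℤ.+-inverseʳ x)) ∣0)

  ≈-sym : ∀ {x y} → x ≈ y [ m ] → y ≈ x [ m ]
  ≈-sym {x} {y} (congruent m∣x-y) = congruent (subst (+ m ∣ˢ_) (lemma x y) (∣m⇒∣-m m∣x-y))
    where
    lemma : ∀ x y → - (x - y) ≡ y - x
    lemma = solve-∀

  ∣-resp-≈ : ∀ {x y} → x ≈ y [ m ] → + m ∣ˢ y → + m ∣ˢ x
  ∣-resp-≈ {x} {y} (congruent m∣x-y) m∣y = subst (+ m ∣ˢ_) (lemma x y) (∣m∣n⇒∣m+n m∣x-y m∣y)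
    where
    lemma : ∀ x y → x - y + y ≡ x
    lemma = solve-∀

  ∣⇒≈0 : ∀ {x} → + m ∣ˢ x → x ≈ + 0 [ m ]
  ∣⇒≈0 {x} m∣x = congruent (subst (+ m ∣ˢ_) (sym (ℤ.+-identityʳ x)) m∣x)

  ≈-isCongruence : IsCongruence (_≈_[ m ])
  ≈-isCongruence = record
    { ~-refl = ≡⇒≈ refl
    ; +-~ = λ {w} {x} {y} {z} (congruent w≈x) (congruent y≈z) →
        congruent (subst (+ m ∣ˢ_) (+-lemma w x y z) (∣m∣n⇒∣m+n w≈x y≈z))
    ; *-~ = λ {w} {x} {y} {z} (congruent w≈x) (congruent y≈z) →
        congruent (subst (+ m ∣ˢ_) (*-lemma w x y z) (∣m∣n⇒∣m+n (∣m⇒∣m*n y w≈x) (∣n⇒∣m*n x y≈z)))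
    }
    where
    +-lemma : ∀ w x y z → (w - x) + (y - z) ≡ w + y - (x + z)
    +-lemma = solve-∀
    *-lemma : ∀ w x y z → (w - x) * y + x * (y - z) ≡ w * y - x * z
    *-lemma = solve-∀

∣-sum : ∀ {k n} {f : Vector ℤ n} → (∀ i → k ∣ˢ f i) → k ∣ˢ sum f
∣-sum {n = zero}  k∣f = ∣0
∣-sum {n = suc n} k∣f = ∣m∣n⇒∣m+n (k∣f zero) (∣-sum (k∣f ∘ suc))

det-∣ : ∀ {k n} {A : Matrix (suc n) (suc n)} → (∀ j → k ∣ˢ A zero j) → k ∣ˢ det (suc n) A
det-∣ {k} {n} {A} k∣A = subst (k ∣ˢ_) (sym (det-laplace n A))
  (∣-sum λ j → ∣n⇒∣m*n (sgn (toℕ j)) (∣m⇒∣m*n (det n (minor A j)) (k∣A j)))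

-- The first row supplies one factor k and the first row of each minor another, which is where size
-- at least 2 enters statement (4).
det-∣² : ∀ {k n} {A : Matrix (suc (suc n)) (suc (suc n))} → (∀ i j → k ∣ˢ A i j) → k * k ∣ˢ det (suc (suc n)) A
det-∣² {k} {n} {A} k∣A = subst (k * k ∣ˢ_) (sym (det-laplace (suc n) A)) (∣-sum λ j → ∣n⇒∣m*n (sgn (toℕ j))
  (∣-trans (*-monoʳ-∣ k (det-∣ {A = minor A j} λ c → k∣A (suc zero) (punchIn j c))) (*-monoˡ-∣ (det (suc n) (minor A j)) (k∣A zero j))))

-- Adding multiples of the other rows to the first row does not change the determinant.
det-∣-combination : ∀ {k n} {A : Matrix (suc n) (suc n)} (r : Vector ℤ (suc n)) → r zero ≡ + 1 →
  (∀ j → k ∣ˢ ∑[ i < suc n ] (r i * A i j)) → k ∣ˢ det (suc n) A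
det-∣-combination {k} {n} {A} r r0≡1 k∣rA = subst (k ∣ˢ_) det-B (det-∣ {A = B} k∣rA)
  where
  open Alternating (det-alternating (suc n))
  B : Matrix (suc n) (suc n)
  B = (λ j → ∑[ i < suc n ] (r i * A i j)) ◂ tail A
  det-B : det (suc n) B ≡ det (suc n) A
  det-B = begin
    det (suc n) B                                          ≡⟨ row-sum (det-alternating (suc n)) r A (tail A) ⟩
    r zero * det (suc n) (A zero ◂ tail A) + ∑[ i < n ] (r (suc i) * det (suc n) (A (suc i) ◂ tail A))
      ≡⟨ cong₂ _+_ (cong₂ _*_ r0≡1 (ext {A zero ◂ tail A} {A} λ { zero _ → refl ; (suc i) _ → refl }))
          (sum-zero λ i → trans (cong (r (suc i) *_) (alt {A (suc i) ◂ tail A} zero (suc i) (λ ()) λ _ → refl)) (ℤ.*-zeroʳ (r (suc i)))) ⟩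
    + 1 * det (suc n) A + + 0                               ≡⟨ trans (ℤ.+-identityʳ _) (ℤ.*-identityˡ _) ⟩
    det (suc n) A                                           ∎
    where open ≡-Reasoning

-- Coefficients and degrees modulo m

coeff-addP : ∀ f g k → PZ.coeff (PZ.addP f g) k ≡ PZ.coeff f k + PZ.coeff g k
coeff-addP []       g        k       = sym (ℤ.+-identityˡ (PZ.coeff g k))
coeff-addP (a ∷ as) []       k       = sym (ℤ.+-identityʳ (PZ.coeff (a ∷ as) k))
coeff-addP (a ∷ as) (b ∷ bs) zero    = refl
coeff-addP (a ∷ as) (b ∷ bs) (suc k) = coeff-addP as bs k

coeff-scale : ∀ a g k → PZ.coeff (map (a *_) g) k ≡ a * PZ.coeff g k
coeff-scale a []       k       = sym (ℤ.*-zeroʳ a)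
coeff-scale a (b ∷ bs) zero    = refl
coeff-scale a (b ∷ bs) (suc k) = coeff-scale a bs k

coeff-mulP : ∀ a as g k → PZ.coeff (PZ.mulP (a ∷ as) g) k ≡ a * PZ.coeff g k + PZ.coeff (+ 0 ∷ PZ.mulP as g) k
coeff-mulP a as g k = trans (coeff-addP (map (a *_) g) (+ 0 ∷ PZ.mulP as g) k)
  (cong (_+ PZ.coeff (+ 0 ∷ PZ.mulP as g) k) (coeff-scale a g k))

coeff-mulP-const : ∀ a g k → PZ.coeff (PZ.mulP (a ∷ []) g) k ≡ a * PZ.coeff g k
coeff-mulP-const a g k = trans (coeff-mulP a [] g k) (trans (cong (λ x → a * PZ.coeff g k + x) (zeros k)) (ℤ.+-identityʳ _))
  where
  zeros : ∀ k → PZ.coeff (+ 0 ∷ []) k ≡ + 0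
  zeros zero    = refl
  zeros (suc k) = refl

coeff-toList-linear : ∀ {n} x (v w : Vector ℤ n) k →
  PZ.coeff (toList (λ i → x * v i + w i)) k ≡ x * PZ.coeff (toList v) k + PZ.coeff (toList w) k
coeff-toList-linear {zero}  x v w k       = sym (trans (ℤ.+-identityʳ (x * + 0)) (ℤ.*-zeroʳ x))
coeff-toList-linear {suc n} x v w zero    = refl
coeff-toList-linear {suc n} x v w (suc k) = coeff-toList-linear x (v ∘ suc) (w ∘ suc) k

coeff-toList-zero : ∀ n k → PZ.coeff (toList {n = n} (λ _ → + 0)) k ≡ + 0
coeff-toList-zero zero    k       = refl
coeff-toList-zero (suc n) zero    = refl
coeff-toList-zero (suc n) (suc k) = coeff-toList-zero n k

coeff-toList-≥ : ∀ {n} (v : Vector ℤ n) {k} → n ≤ k → PZ.coeff (toList v) k ≡ + 0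
coeff-toList-≥ {zero}  v z≤n       = refl
coeff-toList-≥ {suc n} v (s≤s n≤k) = coeff-toList-≥ (v ∘ suc) n≤k

coeff-toList : ∀ {n} (v : Vector ℤ n) i → PZ.coeff (toList v) (toℕ i) ≡ v i
coeff-toList v zero    = refl
coeff-toList v (suc i) = coeff-toList (v ∘ suc) i

coeff-toList-< : ∀ {n} (f : ℕ → ℤ) {k} g → k < n → PZ.coeff (toList {n = n} (f ∘ toℕ) ++ g) k ≡ f k
coeff-toList-< {suc n} f {zero}  g _         = refl
coeff-toList-< {suc n} f {suc k} g (s≤s k<n) = coeff-toList-< (f ∘ suc) g k<n

coeff-monic-lead : ∀ {n} (v : Vector ℤ n) → PZ.coeff (monicList v) n ≡ + 1
coeff-monic-lead {zero}  v = refl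
coeff-monic-lead {suc n} v = coeff-monic-lead (v ∘ suc)

coeff-monic-> : ∀ {n} (v : Vector ℤ n) {k} → n < k → PZ.coeff (monicList v) k ≡ + 0
coeff-monic-> {zero}  v (s≤s _)   = refl
coeff-monic-> {suc n} v (s≤s n<k) = coeff-monic-> (v ∘ suc) n<k

module _ {m : ℕ} where
  open IsCongruence (≈-isCongruence {m})

  mulP-vanish : ∀ f g → (∀ k → + m ∣ˢ PZ.coeff f k) → ∀ k → + m ∣ˢ PZ.coeff (PZ.mulP f g) k
  mulP-vanish []       g m∣f k       = ∣0
  mulP-vanish (a ∷ as) g m∣f k = subst (+ m ∣ˢ_) (sym (coeff-mulP a as g k))
    (∣m∣n⇒∣m+n (∣m⇒∣m*n (PZ.coeff g k) (m∣f 0)) (tail-vanish k))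
    where
    tail-vanish : ∀ k → + m ∣ˢ PZ.coeff (+ 0 ∷ PZ.mulP as g) k
    tail-vanish zero    = ∣0
    tail-vanish (suc k) = mulP-vanish as g (m∣f ∘ suc) k

  -- Here d and e are only upper bounds for the degrees mod m. The congruence thus also shows that a
  -- coefficient vanishes, when a bound is chosen too large.
  mulP-top : ∀ f g d e → (∀ k → d < k → + m ∣ˢ PZ.coeff f k) → (∀ k → e < k → + m ∣ˢ PZ.coeff g k) →
    PZ.coeff (PZ.mulP f g) (d ℕ.+ e) ≈ PZ.coeff f d * PZ.coeff g e [ m ]
  mulP-top []       g d e f> g> = ≡⇒≈ (sym (ℤ.*-zeroˡ (PZ.coeff g e)))
  mulP-top (a ∷ as) g zero e f> g> = subst₂ (_≈_[ m ]) (sym (coeff-mulP a as g e)) (ℤ.+-identityʳ _)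
    (+-~ (~-refl {a * PZ.coeff g e}) (∣⇒≈0 (mulP-vanish′ e)))
    where
    mulP-vanish′ : ∀ k → + m ∣ˢ PZ.coeff (+ 0 ∷ PZ.mulP as g) k
    mulP-vanish′ zero    = ∣0
    mulP-vanish′ (suc k) = mulP-vanish as g (λ k → f> (suc k) (s≤s z≤n)) k
  mulP-top (a ∷ as) g (suc d) e f> g> = subst₂ (_≈_[ m ]) (sym (coeff-mulP a as g (suc (d ℕ.+ e)))) (ℤ.+-identityˡ _)
    (+-~ (∣⇒≈0 (∣n⇒∣m*n a (g> _ (s≤s (ℕ.m≤n+m e d))))) (mulP-top as g d e (λ k d<k → f> (suc k) (s≤s d<k)) g>))

  HasDegree : List ℤ → ℕ → Set
  HasDegree f d = ¬ + m ∣ˢ PZ.coeff f d × (∀ k → d < k → + m ∣ˢ PZ.coeff f k)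

  degree? : ∀ f → (∀ k → + m ∣ˢ PZ.coeff f k) ⊎ ∃ (HasDegree f)
  degree? []       = inj₁ λ _ → ∣0
  degree? (a ∷ as) with degree? as
  ... | inj₂ (d , as-d , as>) = inj₂ (suc d , as-d , λ { (suc k) (s≤s d<k) → as> k d<k })
  ... | inj₁ m∣as with + m ∣? a
  ...   | yes m∣a = inj₁ λ { zero → m∣a ; (suc k) → m∣as k }
  ...   | no m∤a  = inj₂ (0 , m∤a , λ { (suc k) _ → m∣as k })

  nonConst⇒degree : ∀ f → NonConstMod m f → ∃ λ d → 0 < d × HasDegree f d
  nonConst⇒degree f (k , m∤fk) with degree? f
  ... | inj₁ m∣f = ⊥-elim (m∤fk (∣⇒∣ᵤ (m∣f (suc k))))
  ... | inj₂ (suc d , deg) = suc d , s≤s z≤n , deg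
  ... | inj₂ (zero , _ , f>) = ⊥-elim (m∤fk (∣⇒∣ᵤ (f> (suc k) (s≤s z≤n))))

  constMod : ∀ f → NonConstMod m f ⊎ (∀ k → 0 < k → + m ∣ˢ PZ.coeff f k)
  constMod f with degree? f
  ... | inj₁ m∣f = inj₂ λ k _ → m∣f k
  ... | inj₂ (suc d , m∤fd , _) = inj₁ (d , m∤fd ∘ ∣ᵤ⇒∣)
  ... | inj₂ (zero , _ , f>) = inj₂ f>

-- From a factorization to a zero of the norm form

IsPrimeModulus : ℕ → Set
IsPrimeModulus m = ∀ x y → + m ∣ˢ x * y → + m ∣ˢ x ⊎ + m ∣ˢ y

-- The scalar t makes room for cleared denominators in the rational case; modulo p it is 1.
factors⇒norm-zero : ∀ {m n} → IsPrimeModulus m → (c : Vector ℤ (suc n)) → ∀ a b t → NonConstMod m a → NonConstMod m b →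
  (∀ k → PZ.coeff (PZ.mulP a b) k ≈ t * PZ.coeff (monicList c) k [ m ]) →
  ∃ λ (xs : Vector ℤ (suc n)) → (∃ λ i → ¬ (+ m ∣ˢ xs i)) × + m ∣ˢ D c xs
factors⇒norm-zero {m} {n} prime c a b t a-nonconst b-nonconst ab≈tq =
  result (nonConst⇒degree a a-nonconst) (nonConst⇒degree b b-nonconst) (prime (norm a) (norm b) m∣norm*norm)
  where
  open QuotientRing c

  m∣norm*norm : + m ∣ˢ norm a * norm b
  -- The product a b acts as t q, hence as zero mod m; its first row is enough for `det-∣`.
  m∣norm*norm = subst (+ m ∣ˢ_) (norm-mulP a b) (det-∣ {A = mulMatrix (PZ.mulP a b)} λ j →
    ∣-resp-≈ (act-coeff ≈-isCongruence (PZ.mulP a b) (map (t *_) (monicList c)) coeffs≈ (δ j) zero)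
      (subst (+ m ∣ˢ_) (sym (act-tq j)) ∣0))
    where
    coeffs≈ : ∀ k → PZ.coeff (PZ.mulP a b) k ≈ PZ.coeff (map (t *_) (monicList c)) k [ m ]
    coeffs≈ k = subst (PZ.coeff (PZ.mulP a b) k ≈_[ m ]) (sym (coeff-scale t (monicList c) k)) (ab≈tq k)
    act-tq : ∀ j → act (map (t *_) (monicList c)) (δ j) zero ≡ + 0
    act-tq j = trans (act-scale t (monicList c) (δ j) zero) (trans (cong (t *_) (act-monic (δ j) zero)) (ℤ.*-zeroʳ t))

  -- The coefficient of a b at d + e is, mod m, a product of two non-multiples of m, while t q has
  -- only zeros beyond degree `suc n`. As both degrees are positive, each factor then has degree
  -- below `suc n`.
  degrees-bounded : ∀ d e → HasDegree {m} a d → HasDegree {m} b e → d ℕ.+ e ≤ suc n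
  degrees-bounded d e (m∤ad , a>) (m∤be , b>) = ℕ.≮⇒≥ λ n<d+e → contra (prime _ _ (∣-resp-≈ (≈-sym (mulP-top a b d e a> b>))
    (∣-resp-≈ (ab≈tq (d ℕ.+ e)) (subst (λ x → + m ∣ˢ t * x) (sym (coeff-monic-> c n<d+e)) (∣n⇒∣m*n t ∣0)))))
    where
    contra : + m ∣ˢ PZ.coeff a d ⊎ + m ∣ˢ PZ.coeff b e → _
    contra (inj₁ m∣ad) = m∤ad m∣ad
    contra (inj₂ m∣be) = m∤be m∣be

  -- The list f may be longer than `suc n`, but the excess coefficients are multiples of m: cutting
  -- them off preserves the norm mod m, and position d keeps the solution non-trivial.
  truncate : ∀ f d → d < suc n → HasDegree {m} f d → + m ∣ˢ norm f →
    ∃ λ (xs : Vector ℤ (suc n)) → (∃ λ i → ¬ (+ m ∣ˢ xs i)) × + m ∣ˢ D c xs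
  truncate f d d<n (m∤fd , f>) m∣norm = xs
    , (fromℕ< d<n , λ m∣x → m∤fd (subst (λ k → + m ∣ˢ PZ.coeff f k) (toℕ-fromℕ< d<n) m∣x))
    , subst (+ m ∣ˢ_) (sym (D-norm xs)) (∣-resp-≈ (norm-~ ≈-isCongruence (toList xs) f xs≈f) m∣norm)
    where
    xs : Vector ℤ (suc n)
    xs = PZ.coeff f ∘ toℕ
    xs≈f : ∀ k → PZ.coeff (toList xs) k ≈ PZ.coeff f k [ m ]
    xs≈f k with k ℕ.<? suc n
    ... | yes k<n = ≡⇒≈ (trans (cong (λ l → PZ.coeff l k) (sym (++-identityʳ (toList xs)))) (coeff-toList-< (PZ.coeff f) [] k<n))
    ... | no k≮n = subst (_≈ PZ.coeff f k [ m ]) (sym (coeff-toList-≥ xs (ℕ.≮⇒≥ k≮n)))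
      (≈-sym (∣⇒≈0 (f> k (ℕ.<-≤-trans d<n (ℕ.≮⇒≥ k≮n)))))

  result : (∃ λ d → 0 < d × HasDegree {m} a d) → (∃ λ e → 0 < e × HasDegree {m} b e) → + m ∣ˢ norm a ⊎ + m ∣ˢ norm b →
    ∃ λ (xs : Vector ℤ (suc n)) → (∃ λ i → ¬ (+ m ∣ˢ xs i)) × + m ∣ˢ D c xs
  result (d , 0<d , deg-a) (e , 0<e , deg-b) (inj₁ m∣na) =
    truncate a d (ℕ.<-≤-trans (ℕ.m<m+n d 0<e) (degrees-bounded d e deg-a deg-b)) deg-a m∣na
  result (d , 0<d , deg-a) (e , 0<e , deg-b) (inj₂ m∣nb) =
    truncate b e (ℕ.<-≤-trans (ℕ.m<n+m e 0<d) (degrees-bounded d e deg-a deg-b)) deg-b m∣nb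

-- Division by a monic polynomial

-- One step of long division: subtracting t times a monic polynomial removes the top coefficient t.
coeff-init-last : ∀ {n} (w : Vector ℤ (suc n)) (d : Vector ℤ n) t → w (fromℕ n) ≡ t → ∀ k →
  PZ.coeff (toList w) k ≡ PZ.coeff (toList (λ i → w (inject₁ i) - d i * t)) k + t * PZ.coeff (monicList d) k
coeff-init-last {zero}  w d t w-last zero    = trans w-last (sym (trans (ℤ.+-identityˡ (t * + 1)) (ℤ.*-identityʳ t)))
coeff-init-last {zero}  w d t w-last (suc k) = sym (trans (ℤ.+-identityˡ (t * + 0)) (ℤ.*-zeroʳ t))
coeff-init-last {suc n} w d t w-last zero    = lemma (w zero) (d zero) t
  where
  lemma : ∀ w d t → w ≡ w - d * t + t * d
  lemma = solve-∀
coeff-init-last {suc n} w d t w-last (suc k) = coeff-init-last (w ∘ suc) (d ∘ suc) t w-last k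

module Division {n : ℕ} (c : Vector ℤ (suc n)) where
  open QuotientRing c
  open ≡-Reasoning

  remainder : List ℤ → Vector ℤ (suc n)
  remainder f = act f 𝟙

  -- If `as` is h q + r and l is the top coefficient of r, then x r = U r + l q, so that a + x (h q
  -- + r) = (l + x h) q + (a + U r).
  quotient : List ℤ → List ℤ
  quotient []       = []
  quotient (a ∷ as) = remainder as (fromℕ n) ∷ quotient as

  coeff-U : ∀ w k → PZ.coeff (+ 0 ∷ toList w) k ≡ PZ.coeff (toList (U w)) k + w (fromℕ n) * PZ.coeff (monicList c) k
  coeff-U w zero    = lemma (c zero) (w (fromℕ n))
    where
    lemma : ∀ c t → + 0 ≡ - (c * t) + t * c
    lemma = solve-∀
  coeff-U w (suc k) = coeff-init-last w (c ∘ suc) (w (fromℕ n)) refl k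

  division : ∀ f k → PZ.coeff f k ≡ PZ.coeff (PZ.mulP (quotient f) (monicList c)) k + PZ.coeff (toList (remainder f)) k
  division []       k = sym (trans (ℤ.+-identityˡ _) (coeff-toList-zero (suc n) k))
  division (a ∷ as) k = sym (begin
    PZ.coeff (PZ.mulP (l ∷ h) q) k + PZ.coeff (toList (remainder (a ∷ as))) k
      ≡⟨ cong₂ _+_ (coeff-mulP l h q k) (coeff-toList-linear a 𝟙 (U r) k) ⟩
    l * PZ.coeff q k + PZ.coeff (+ 0 ∷ PZ.mulP h q) k + (a * PZ.coeff (toList 𝟙) k + PZ.coeff (toList (U r)) k)
      ≡⟨ rearrange (l * PZ.coeff q k) (PZ.coeff (+ 0 ∷ PZ.mulP h q) k) (a * PZ.coeff (toList 𝟙) k) (PZ.coeff (toList (U r)) k) ⟩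
    (a * PZ.coeff (toList 𝟙) k + PZ.coeff (+ 0 ∷ PZ.mulP h q) k) + (PZ.coeff (toList (U r)) k + l * PZ.coeff q k)
      ≡⟨ cong (λ x → a * PZ.coeff (toList 𝟙) k + PZ.coeff (+ 0 ∷ PZ.mulP h q) k + x) (coeff-U r k) ⟨
    (a * PZ.coeff (toList 𝟙) k + PZ.coeff (+ 0 ∷ PZ.mulP h q) k) + PZ.coeff (+ 0 ∷ toList r) k
      ≡⟨ by-coefficient k ⟩
    PZ.coeff (a ∷ as) k ∎)
    where
    q = monicList c
    r = remainder as
    l = r (fromℕ n)
    h = quotient as
    rearrange : ∀ w x y z → w + x + (y + z) ≡ (y + x) + (z + w)
    rearrange = solve-∀
    by-coefficient : ∀ k → a * PZ.coeff (toList 𝟙) k + PZ.coeff (+ 0 ∷ PZ.mulP h q) k + PZ.coeff (+ 0 ∷ toList r) k ≡ PZ.coeff (a ∷ as) k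
    by-coefficient zero = lemma a
      where
      lemma : ∀ a → a * + 1 + + 0 + + 0 ≡ a
      lemma = solve-∀
    by-coefficient (suc k) = begin
      a * PZ.coeff (toList {n = n} (λ _ → + 0)) k + PZ.coeff (PZ.mulP h q) k + PZ.coeff (toList r) k
        ≡⟨ cong (λ x → a * x + PZ.coeff (PZ.mulP h q) k + PZ.coeff (toList r) k) (coeff-toList-zero n k) ⟩
      a * + 0 + PZ.coeff (PZ.mulP h q) k + PZ.coeff (toList r) k ≡⟨ lemma a _ _ ⟩
      PZ.coeff (PZ.mulP h q) k + PZ.coeff (toList r) k           ≡⟨ division as k ⟨
      PZ.coeff as k ∎
      where
      lemma : ∀ a x y → a * + 0 + x + y ≡ x + y
      lemma = solve-∀

-- Irreducibility mod p excludes non-trivial zeros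

zero-modulus : IsPrimeModulus 0
zero-modulus x y 0∣xy with ℤ.i*j≡0⇒i≡0∨j≡0 x (0∣⇒≡0 0∣xy)
... | inj₁ refl = inj₁ ∣0
... | inj₂ refl = inj₂ ∣0

module _ {p : ℕ} (p-prime : Prime p) where
  prime-modulus : IsPrimeModulus p
  prime-modulus x y p∣xy with euclidsLemma ℤ.∣ x ∣ ℤ.∣ y ∣ p-prime (subst (p ℕ.∣_) (ℤ.abs-* x y) (∣⇒∣ᵤ p∣xy))
  ... | inj₁ p∣x = inj₁ (∣ᵤ⇒∣ p∣x)
  ... | inj₂ p∣y = inj₂ (∣ᵤ⇒∣ p∣y)

  p∤1 : ¬ + p ∣ˢ + 1
  p∤1 p∣1 = ℕ.nonTrivial⇒≢1 {{prime⇒nonTrivial p-prime}} (ℕ.∣1⇒≡1 (∣⇒∣ᵤ p∣1))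

  inverse-abs : ∀ x → ¬ + p ∣ˢ x → ∃ λ s → s * + ℤ.∣ x ∣ ≈ + 1 [ p ]
  inverse-abs x p∤x with coprime-Bézout {p} {ℤ.∣ x ∣} p-coprime-x
    where
    p-coprime-x : Coprime p ℤ.∣ x ∣
    p-coprime-x {d} (d∣p , d∣x) with prime⇒irreducible p-prime d∣p
    ... | inj₁ d≡1 = d≡1
    ... | inj₂ refl = ⊥-elim (p∤x (∣ᵤ⇒∣ d∣x))
  ... | Bézout.+- a b eq = - + b , congruent (divides (- + a) (begin
    - + b * + ℤ.∣ x ∣ - + 1       ≡⟨ lemma (+ b) (+ ℤ.∣ x ∣) ⟩
    - (+ 1 + + b * + ℤ.∣ x ∣)     ≡⟨ cong (λ z → - (+ 1 + z)) (ℤ.pos-* b ℤ.∣ x ∣) ⟨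
    - + (1 ℕ.+ b ℕ.* ℤ.∣ x ∣)     ≡⟨ cong (λ z → - + z) eq ⟩
    - + (a ℕ.* p)                 ≡⟨ cong -_ (ℤ.pos-* a p) ⟩
    - (+ a * + p)                 ≡⟨ ℤ.neg-distribˡ-* (+ a) (+ p) ⟩
    - + a * + p                   ∎))
    where
    open ≡-Reasoning
    lemma : ∀ b x → - b * x - + 1 ≡ - (+ 1 + b * x)
    lemma = solve-∀
  ... | Bézout.-+ a b eq = + b , congruent (divides (+ a) (begin
    + b * + ℤ.∣ x ∣ - + 1         ≡⟨ cong (_- + 1) (ℤ.pos-* b ℤ.∣ x ∣) ⟨
    + (b ℕ.* ℤ.∣ x ∣) - + 1       ≡⟨ cong (λ z → + z - + 1) eq ⟨
    + 1 + + (a ℕ.* p) - + 1       ≡⟨ lemma (+ (a ℕ.* p)) ⟩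
    + (a ℕ.* p)                   ≡⟨ ℤ.pos-* a p ⟩
    + a * + p                     ∎))
    where
    open ≡-Reasoning
    lemma : ∀ x → + 1 + x - + 1 ≡ x
    lemma = solve-∀

  inverse : ∀ x → ¬ + p ∣ˢ x → ∃ λ s → s * x ≈ + 1 [ p ]
  inverse (+ n)      p∤x = inverse-abs (+ n) p∤x
  inverse x@(-[1+ n ]) p∤x with inverse-abs x p∤x
  ... | s , eq = - s , subst (_≈ + 1 [ p ]) (lemma s (+ suc n)) eq
    where
    lemma : ∀ s x → s * x ≡ - s * - x
    lemma = solve-∀

  module _ {n : ℕ} (c : Vector ℤ (suc n)) (irreducible : IrreducibleModP p (monicList c)) where
    open QuotientRing c
    open IsCongruence (≈-isCongruence {p})

    ∣norm-mulP : ∀ f g → + p ∣ˢ norm g → + p ∣ˢ norm (PZ.mulP f g)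
    ∣norm-mulP f g p∣g = subst (+ p ∣ˢ_) (sym (norm-mulP f g)) (∣n⇒∣m*n (norm f) p∣g)

    -- The two statements recurse on each other: scaling to a monic polynomial keeps d and passes
    -- the accessibility proof on unchanged, and only the division lowers d.
    irreducible⇒p∤norm : ∀ d → Acc _<_ d → d < suc n → ∀ z → HasDegree {p} z d → ¬ + p ∣ˢ norm z
    monic-irreducible⇒p∤norm : ∀ d → Acc _<_ d → d < suc n → (v : Vector ℤ d) → ¬ + p ∣ˢ norm (monicList v)

    irreducible⇒p∤norm d d-acc d<n z (p∤zd , z>) p∣z = monic-irreducible⇒p∤norm d d-acc d<n v
      (∣-resp-≈ (norm-~ ≈-isCongruence (monicList v) (PZ.mulP (s ∷ []) z) λ k →
          subst (PZ.coeff (monicList v) k ≈_[ p ]) (sym (coeff-mulP-const s z k)) (v≈sz k (ℕ.<-cmp k d)))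
        (∣norm-mulP (s ∷ []) z p∣z))
      where
      s = proj₁ (inverse (PZ.coeff z d) p∤zd)
      v : Vector ℤ d
      v i = s * PZ.coeff z (toℕ i)
      v≈sz : ∀ k → Tri (k < d) (k ≡ d) (d < k) → PZ.coeff (monicList v) k ≈ s * PZ.coeff z k [ p ]
      v≈sz k (tri< k<d _ _)  = ≡⇒≈ (coeff-toList-< (λ k → s * PZ.coeff z k) (+ 1 ∷ []) k<d)
      v≈sz k (tri≈ _ refl _) = subst (_≈ s * PZ.coeff z d [ p ]) (sym (coeff-monic-lead v)) (≈-sym (proj₂ (inverse (PZ.coeff z d) p∤zd)))
      v≈sz k (tri> _ _ d<k)  = subst (_≈ s * PZ.coeff z k [ p ]) (sym (coeff-monic-> v d<k)) (≈-sym (∣⇒≈0 (∣n⇒∣m*n s (z> k d<k))))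

    monic-irreducible⇒p∤norm zero _ _ v p∣norm = p∤1 (subst (+ p ∣ˢ_) norm-one p∣norm)
      where
      norm-one : norm (+ 1 ∷ []) ≡ + 1
      norm-one = trans (det-cong (suc n) (λ i j → trans (cong (λ x → + 1 * δ j i + x) (U-zero i))
        (trans (ℤ.+-identityʳ _) (trans (ℤ.*-identityˡ (δ j i)) (δ-sym j i))))) (det-δ (suc n))
    monic-irreducible⇒p∤norm (suc d) (acc rec) d<n v p∣z = by-remainder (degree? r)
      where
      -- Two quotient rings are in play: the division is by z, while all norms are taken modulo q.
      module z = Division v
      q = monicList c
      z = monicList v
      h = z.quotient q
      r = toList (z.remainder q)

      coeff-hz : ∀ k → PZ.coeff q k ≡ PZ.coeff (PZ.mulP h z) k + PZ.coeff r k
      coeff-hz = z.division q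

      p∣norm-r : + p ∣ˢ norm r
      p∣norm-r = subst (+ p ∣ˢ_) (sym norm-r) (∣norm-mulP (- + 1 ∷ []) (PZ.mulP h z) (∣norm-mulP h z p∣z))
        where
        -- The sign is written as the constant polynomial -1, so that multiplicativity takes care of
        -- it and no power of -1 has to be computed.
        norm-r : norm r ≡ norm (PZ.mulP (- + 1 ∷ []) (PZ.mulP h z))
        norm-r = det-cong (suc n) λ i j → begin
          act r (δ j) i ≡⟨ lemma (act (PZ.mulP h z) (δ j) i) (act r (δ j) i) ⟩
          - + 1 * act (PZ.mulP h z) (δ j) i + (act (PZ.mulP h z) (δ j) i + act r (δ j) i)
            ≡⟨ cong (λ x → - + 1 * act (PZ.mulP h z) (δ j) i + x) (act-hz+r j i) ⟩
          - + 1 * act (PZ.mulP h z) (δ j) i + + 0 ≡⟨ cong (λ x → - + 1 * act (PZ.mulP h z) (δ j) i + x) (U-zero i) ⟨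
          act (- + 1 ∷ []) (act (PZ.mulP h z) (δ j)) i ≡⟨ act-mulP (- + 1 ∷ []) (PZ.mulP h z) (δ j) i ⟨
          act (PZ.mulP (- + 1 ∷ []) (PZ.mulP h z)) (δ j) i ∎
          where
          open ≡-Reasoning
          lemma : ∀ x y → y ≡ - + 1 * x + (x + y)
          lemma = solve-∀
          act-hz+r : ∀ j i → act (PZ.mulP h z) (δ j) i + act r (δ j) i ≡ + 0
          act-hz+r j i = begin
            act (PZ.mulP h z) (δ j) i + act r (δ j) i ≡⟨ act-addP (PZ.mulP h z) r (δ j) i ⟨
            act (PZ.addP (PZ.mulP h z) r) (δ j) i ≡⟨ act-coeff ≡-isCongruence (PZ.addP (PZ.mulP h z) r) q
                (λ k → trans (coeff-addP (PZ.mulP h z) r k) (sym (coeff-hz k))) (δ j) i ⟩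
            act q (δ j) i ≡⟨ act-monic (δ j) i ⟩
            + 0 ∎

      reducible : (∀ k → + p ∣ˢ PZ.coeff r k) → ReducibleModP p q
      reducible p∣r = h , z , h-nonconst (constMod h) , z-nonconst , λ k → ∣⇒∣ᵤ (∣-difference (hz≈q k))
        where
        hz≈q : ∀ k → PZ.coeff (PZ.mulP h z) k ≈ PZ.coeff q k [ p ]
        hz≈q k = subst₂ (_≈_[ p ]) (ℤ.+-identityʳ _) (sym (coeff-hz k)) (+-~ (~-refl {PZ.coeff (PZ.mulP h z) k}) (≈-sym (∣⇒≈0 (p∣r k))))
        z-nonconst : NonConstMod p z
        z-nonconst = d , λ p∣1 → p∤1 (subst (+ p ∣ˢ_) (coeff-monic-lead v) (∣ᵤ⇒∣ p∣1))
        h-nonconst : NonConstMod p h ⊎ (∀ k → 0 < k → + p ∣ˢ PZ.coeff h k) → NonConstMod p h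
        h-nonconst (inj₁ nonconst) = nonconst
        -- If h were constant mod p, then h z would have degree at most `suc d`, which is below
        -- `suc n`, yet q has coefficient 1 at `suc n`. `mulP-top` is used with the bounds 0 and
        -- `suc n`.
        h-nonconst (inj₂ h>) = ⊥-elim (p∤1 (subst (+ p ∣ˢ_) (coeff-monic-lead c) (∣-resp-≈ (≈-sym (hz≈q (suc n)))
          (∣-resp-≈ (mulP-top h z 0 (suc n) h> (λ k n<k → subst (+ p ∣ˢ_) (sym (coeff-monic-> v (ℕ.<-trans d<n n<k))) ∣0))
            (subst (λ x → + p ∣ˢ PZ.coeff h 0 * x) (sym (coeff-monic-> v d<n)) (∣n⇒∣m*n (PZ.coeff h 0) ∣0))))))

      by-remainder : (∀ k → + p ∣ˢ PZ.coeff r k) ⊎ ∃ (HasDegree {p} r) → _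
      by-remainder (inj₁ p∣r) = irreducible (reducible p∣r)
      by-remainder (inj₂ (e , r-deg@(p∤re , _))) = irreducible⇒p∤norm e (rec e<d) (ℕ.<-trans e<d d<n) r r-deg p∣norm-r
        where
        e<d : e < suc d
        e<d = ℕ.≰⇒> λ d≤e → p∤re (subst (+ p ∣ˢ_) (sym (coeff-toList-≥ (z.remainder q) d≤e)) ∣0)

    irreducible⇒no-zero : ∀ xs → + p ∣ˢ D c xs → ∀ i → + p ∣ˢ xs i
    irreducible⇒no-zero xs p∣D i = by-degree (degree? (toList xs))
      where
      by-degree : (∀ k → + p ∣ˢ PZ.coeff (toList xs) k) ⊎ ∃ (HasDegree {p} (toList xs)) → + p ∣ˢ xs i
      by-degree (inj₁ p∣xs) = subst (+ p ∣ˢ_) (coeff-toList xs i) (p∣xs (toℕ i))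
      by-degree (inj₂ (d , deg@(p∤xd , _))) = ⊥-elim (irreducible⇒p∤norm d (<-wellFounded d)
        (ℕ.≰⇒> λ n≤d → p∤xd (subst (+ p ∣ˢ_) (sym (coeff-toList-≥ xs n≤d)) ∣0)) (toList xs) deg (subst (+ p ∣ˢ_) (D-norm xs) p∣D))

-- Clearing denominators

fromℤ : ℤ → ℚ
fromℤ z = z ℚ./ 1

toℚᵘ-fromℤ : ∀ z → toℚᵘ (fromℤ z) ℚᵘ.≃ mkℚᵘ z 0
toℚᵘ-fromℤ z = ℚ.toℚᵘ-fromℚᵘ (mkℚᵘ z 0)

fromℤ-+ : ∀ x y → fromℤ (x + y) ≡ fromℤ x ℚ.+ fromℤ y
fromℤ-+ x y = ℚ.toℚᵘ-injective (begin
  toℚᵘ (fromℤ (x + y))               ≈⟨ toℚᵘ-fromℤ (x + y) ⟩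
  mkℚᵘ (x + y) 0                     ≈⟨ *≡* (lemma x y) ⟩
  mkℚᵘ x 0 ℚᵘ.+ mkℚᵘ y 0             ≈⟨ ℚᵘ.+-cong (toℚᵘ-fromℤ x) (toℚᵘ-fromℤ y) ⟨
  toℚᵘ (fromℤ x) ℚᵘ.+ toℚᵘ (fromℤ y) ≈⟨ ℚ.toℚᵘ-homo-+ (fromℤ x) (fromℤ y) ⟨
  toℚᵘ (fromℤ x ℚ.+ fromℤ y)         ∎)
  where
  open ℚᵘ.≃-Reasoning
  lemma : ∀ x y → (x + y) * + 1 ≡ (x * + 1 + y * + 1) * + 1
  lemma = solve-∀

fromℤ-* : ∀ x y → fromℤ (x * y) ≡ fromℤ x ℚ.* fromℤ y
fromℤ-* x y = ℚ.toℚᵘ-injective (begin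
  toℚᵘ (fromℤ (x * y))               ≈⟨ toℚᵘ-fromℤ (x * y) ⟩
  mkℚᵘ x 0 ℚᵘ.* mkℚᵘ y 0             ≈⟨ ℚᵘ.*-cong (toℚᵘ-fromℤ x) (toℚᵘ-fromℤ y) ⟨
  toℚᵘ (fromℤ x) ℚᵘ.* toℚᵘ (fromℤ y) ≈⟨ ℚ.toℚᵘ-homo-* (fromℤ x) (fromℤ y) ⟨
  toℚᵘ (fromℤ x ℚ.* fromℤ y)         ∎)
  where open ℚᵘ.≃-Reasoning

fromℤ-injective : ∀ {x y} → fromℤ x ≡ fromℤ y → x ≡ y
fromℤ-injective {x} {y} eq with ℚᵘ.≃-trans (ℚᵘ.≃-sym (toℚᵘ-fromℤ x)) (ℚᵘ.≃-trans (ℚᵘ.≃-reflexive (cong toℚᵘ eq)) (toℚᵘ-fromℤ y))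
... | *≡* x*1≡y*1 = trans (sym (ℤ.*-identityʳ x)) (trans x*1≡y*1 (ℤ.*-identityʳ y))

fromℤ-numerator : ∀ a → fromℤ (ℚ.↥ a) ≡ fromℤ (ℚ.↧ a) ℚ.* a
fromℤ-numerator a@(mkℚ n d-1 _) = ℚ.toℚᵘ-injective (begin
  toℚᵘ (fromℤ n)                      ≈⟨ toℚᵘ-fromℤ n ⟩
  mkℚᵘ n 0                            ≈⟨ *≡* (trans (cong (λ k → n * + suc k) (ℕ.+-identityʳ d-1)) (lemma n (+ suc d-1))) ⟩
  mkℚᵘ (+ suc d-1) 0 ℚᵘ.* mkℚᵘ n d-1  ≈⟨ ℚᵘ.*-cong (toℚᵘ-fromℤ (+ suc d-1)) (ℚᵘ.≃-refl {mkℚᵘ n d-1}) ⟨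
  toℚᵘ (fromℤ (+ suc d-1)) ℚᵘ.* toℚᵘ a ≈⟨ ℚ.toℚᵘ-homo-* (fromℤ (+ suc d-1)) a ⟨
  toℚᵘ (fromℤ (+ suc d-1) ℚ.* a)      ∎)
  where
  open ℚᵘ.≃-Reasoning
  lemma : ∀ n d → n * d ≡ d * n * + 1
  lemma = solve-∀

-- The common denominator d is the product of all denominators. An equation of lists, rather than of
-- coefficients, keeps both lists equally long, so that later inductions can run through them in
-- parallel.
clear-denominators : ∀ (a : List ℚ) → ∃ λ d → ∃ λ A → d ≢ + 0 × map fromℤ A ≡ map (fromℤ d ℚ.*_) a
clear-denominators [] = + 1 , [] , (λ ()) , refl
clear-denominators (a ∷ as) with clear-denominators as
... | d , A , d≢0 , A≡das = ℚ.↧ a * d , ℚ.↥ a * d ∷ map (ℚ.↧ a *_) A , denominator≢0 , cong₂ _∷_ head≡ (tail≡ A as A≡das)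
  where
  open ≡-Reasoning
  denominator≢0 : ℚ.↧ a * d ≢ + 0
  denominator≢0 eq with ℤ.i*j≡0⇒i≡0∨j≡0 (ℚ.↧ a) eq
  ... | inj₁ ()
  ... | inj₂ d≡0 = d≢0 d≡0
  head≡ : fromℤ (ℚ.↥ a * d) ≡ fromℤ (ℚ.↧ a * d) ℚ.* a
  head≡ = begin
    fromℤ (ℚ.↥ a * d)                         ≡⟨ fromℤ-* (ℚ.↥ a) d ⟩
    fromℤ (ℚ.↥ a) ℚ.* fromℤ d                 ≡⟨ cong (ℚ._* fromℤ d) (fromℤ-numerator a) ⟩
    fromℤ (ℚ.↧ a) ℚ.* a ℚ.* fromℤ d           ≡⟨ ℚ.*-assoc (fromℤ (ℚ.↧ a)) a (fromℤ d) ⟩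
    fromℤ (ℚ.↧ a) ℚ.* (a ℚ.* fromℤ d)         ≡⟨ cong (fromℤ (ℚ.↧ a) ℚ.*_) (ℚ.*-comm a (fromℤ d)) ⟩
    fromℤ (ℚ.↧ a) ℚ.* (fromℤ d ℚ.* a)         ≡⟨ ℚ.*-assoc (fromℤ (ℚ.↧ a)) (fromℤ d) a ⟨
    fromℤ (ℚ.↧ a) ℚ.* fromℤ d ℚ.* a           ≡⟨ cong (ℚ._* a) (fromℤ-* (ℚ.↧ a) d) ⟨
    fromℤ (ℚ.↧ a * d) ℚ.* a                   ∎
  tail≡ : ∀ A as → map fromℤ A ≡ map (fromℤ d ℚ.*_) as → map fromℤ (map (ℚ.↧ a *_) A) ≡ map (fromℤ (ℚ.↧ a * d) ℚ.*_) as
  tail≡ []      []       eq = refl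
  tail≡ (x ∷ A) (y ∷ as) eq = cong₂ _∷_ (begin
    fromℤ (ℚ.↧ a * x)                 ≡⟨ fromℤ-* (ℚ.↧ a) x ⟩
    fromℤ (ℚ.↧ a) ℚ.* fromℤ x         ≡⟨ cong (fromℤ (ℚ.↧ a) ℚ.*_) (∷-injectiveˡ eq) ⟩
    fromℤ (ℚ.↧ a) ℚ.* (fromℤ d ℚ.* y) ≡⟨ ℚ.*-assoc (fromℤ (ℚ.↧ a)) (fromℤ d) y ⟨
    fromℤ (ℚ.↧ a) ℚ.* fromℤ d ℚ.* y   ≡⟨ cong (ℚ._* y) (fromℤ-* (ℚ.↧ a) d) ⟨
    fromℤ (ℚ.↧ a * d) ℚ.* y           ∎) (tail≡ A as (∷-injectiveʳ eq))

coeff-fromℤ : ∀ s A a → map fromℤ A ≡ map (s ℚ.*_) a → ∀ k → fromℤ (PZ.coeff A k) ≡ s ℚ.* PQ.coeff a k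
coeff-fromℤ s []      []       eq k       = sym (ℚ.*-zeroʳ s)
coeff-fromℤ s (x ∷ A) (y ∷ as) eq zero    = ∷-injectiveˡ eq
coeff-fromℤ s (x ∷ A) (y ∷ as) eq (suc k) = coeff-fromℤ s A as (∷-injectiveʳ eq) k

coeff-mulPℚ : ∀ a as g k → PQ.coeff (PQ.mulP (a ∷ as) g) k ≡ a ℚ.* PQ.coeff g k ℚ.+ PQ.coeff (ℚ.0ℚ ∷ PQ.mulP as g) k
coeff-mulPℚ a as g k = trans (coeff-addPℚ (map (a ℚ.*_) g) (ℚ.0ℚ ∷ PQ.mulP as g) k)
  (cong (ℚ._+ PQ.coeff (ℚ.0ℚ ∷ PQ.mulP as g) k) (coeff-scaleℚ g k))
  where
  coeff-addPℚ : ∀ f g k → PQ.coeff (PQ.addP f g) k ≡ PQ.coeff f k ℚ.+ PQ.coeff g k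
  coeff-addPℚ []       g        k       = sym (ℚ.+-identityˡ (PQ.coeff g k))
  coeff-addPℚ (a ∷ as) []       k       = sym (ℚ.+-identityʳ (PQ.coeff (a ∷ as) k))
  coeff-addPℚ (a ∷ as) (b ∷ bs) zero    = refl
  coeff-addPℚ (a ∷ as) (b ∷ bs) (suc k) = coeff-addPℚ as bs k
  coeff-scaleℚ : ∀ g k → PQ.coeff (map (a ℚ.*_) g) k ≡ a ℚ.* PQ.coeff g k
  coeff-scaleℚ []       k       = sym (ℚ.*-zeroʳ a)
  coeff-scaleℚ (b ∷ bs) zero    = refl
  coeff-scaleℚ (b ∷ bs) (suc k) = coeff-scaleℚ bs k

mulP-fromℤ : ∀ s t A B a b → map fromℤ A ≡ map (s ℚ.*_) a → map fromℤ B ≡ map (t ℚ.*_) b →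
  ∀ k → fromℤ (PZ.coeff (PZ.mulP A B) k) ≡ s ℚ.* t ℚ.* PQ.coeff (PQ.mulP a b) k
mulP-fromℤ s t []      B []       b A≡sa B≡tb k = sym (ℚ.*-zeroʳ (s ℚ.* t))
mulP-fromℤ s t (x ∷ A) B (y ∷ as) b A≡sa B≡tb k = begin
  fromℤ (PZ.coeff (PZ.mulP (x ∷ A) B) k)
    ≡⟨ cong fromℤ (coeff-mulP x A B k) ⟩
  fromℤ (x * PZ.coeff B k + PZ.coeff (+ 0 ∷ PZ.mulP A B) k)
    ≡⟨ trans (fromℤ-+ (x * PZ.coeff B k) _) (cong (ℚ._+ fromℤ (PZ.coeff (+ 0 ∷ PZ.mulP A B) k)) (fromℤ-* x (PZ.coeff B k))) ⟩
  fromℤ x ℚ.* fromℤ (PZ.coeff B k) ℚ.+ fromℤ (PZ.coeff (+ 0 ∷ PZ.mulP A B) k)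
    ≡⟨ cong₂ ℚ._+_ (trans (cong₂ ℚ._*_ (∷-injectiveˡ A≡sa) (coeff-fromℤ t B b B≡tb k)) (interchange s y t (PQ.coeff b k))) (shifted k) ⟩
  s ℚ.* t ℚ.* (y ℚ.* PQ.coeff b k) ℚ.+ s ℚ.* t ℚ.* PQ.coeff (ℚ.0ℚ ∷ PQ.mulP as b) k
    ≡⟨ ℚ.*-distribˡ-+ (s ℚ.* t) (y ℚ.* PQ.coeff b k) (PQ.coeff (ℚ.0ℚ ∷ PQ.mulP as b) k) ⟨
  s ℚ.* t ℚ.* (y ℚ.* PQ.coeff b k ℚ.+ PQ.coeff (ℚ.0ℚ ∷ PQ.mulP as b) k)
    ≡⟨ cong (s ℚ.* t ℚ.*_) (coeff-mulPℚ y as b k) ⟨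
  s ℚ.* t ℚ.* PQ.coeff (PQ.mulP (y ∷ as) b) k ∎
  where
  open ≡-Reasoning
  shifted : ∀ k → fromℤ (PZ.coeff (+ 0 ∷ PZ.mulP A B) k) ≡ s ℚ.* t ℚ.* PQ.coeff (ℚ.0ℚ ∷ PQ.mulP as b) k
  shifted zero    = sym (ℚ.*-zeroʳ (s ℚ.* t))
  shifted (suc k) = mulP-fromℤ s t A B as b (∷-injectiveʳ A≡sa) B≡tb k

coeff-toQ : ∀ f k → PQ.coeff (toQ f) k ≡ fromℤ (PZ.coeff f k)
coeff-toQ []      k       = refl
coeff-toQ (a ∷ f) zero    = refl
coeff-toQ (a ∷ f) (suc k) = coeff-toQ f k

nonConst-cleared : ∀ {d A a} → d ≢ + 0 → map fromℤ A ≡ map (fromℤ d ℚ.*_) a → NonConstQ a → NonConstMod 0 A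
nonConst-cleared {d} {A} {a} d≢0 A≡da (k , ak≢0) = k , λ 0∣Ak → ak≢0 (begin
  PQ.coeff a (suc k)                                      ≡⟨ ℚ.*-identityˡ _ ⟨
  ℚ.1ℚ ℚ.* PQ.coeff a (suc k)                             ≡⟨ cong (ℚ._* PQ.coeff a (suc k)) (ℚ.*-inverseˡ (fromℤ d)) ⟨
  ℚ.1/ fromℤ d ℚ.* fromℤ d ℚ.* PQ.coeff a (suc k)         ≡⟨ ℚ.*-assoc (ℚ.1/ fromℤ d) (fromℤ d) _ ⟩
  ℚ.1/ fromℤ d ℚ.* (fromℤ d ℚ.* PQ.coeff a (suc k))       ≡⟨ cong (ℚ.1/ fromℤ d ℚ.*_) (coeff-fromℤ (fromℤ d) A a A≡da (suc k)) ⟨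
  ℚ.1/ fromℤ d ℚ.* fromℤ (PZ.coeff A (suc k))             ≡⟨ cong (λ x → ℚ.1/ fromℤ d ℚ.* fromℤ x) (0∣⇒≡0 (∣ᵤ⇒∣ {+ 0} {PZ.coeff A (suc k)} 0∣Ak)) ⟩
  ℚ.1/ fromℤ d ℚ.* ℚ.0ℚ                                   ≡⟨ ℚ.*-zeroʳ (ℚ.1/ fromℤ d) ⟩
  ℚ.0ℚ                                                    ∎)
  where
  open ≡-Reasoning
  instance
    fromℤ-d-nonZero : ℚ.NonZero (fromℤ d)
    fromℤ-d-nonZero = ℚ.≢-nonZero (d≢0 ∘ fromℤ-injective)

reducibleℚ⇒norm-zero : ∀ {n} (c : Vector ℤ (suc n)) → ReducibleQ (monicList c) →
  ∃ λ (xs : Vector ℤ (suc n)) → (∃ λ i → xs i ≢ + 0) × D c xs ≡ + 0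
reducibleℚ⇒norm-zero c (a , b , a-nonconst , b-nonconst , ab≡q) = over-ℤ (clear-denominators a) (clear-denominators b)
  where
  open ≡-Reasoning
  over-ℤ : (∃ λ d → ∃ λ A → d ≢ + 0 × map fromℤ A ≡ map (fromℤ d ℚ.*_) a) →
           (∃ λ e → ∃ λ B → e ≢ + 0 × map fromℤ B ≡ map (fromℤ e ℚ.*_) b) →
           ∃ λ (xs : Vector ℤ _) → (∃ λ i → xs i ≢ + 0) × D c xs ≡ + 0
  over-ℤ (d , A , d≢0 , A≡da) (e , B , e≢0 , B≡eb)
    = let xs , (i , 0∤xi) , 0∣D = factors⇒norm-zero zero-modulus c A B (d * e)
            (nonConst-cleared {a = a} d≢0 A≡da a-nonconst) (nonConst-cleared {a = b} e≢0 B≡eb b-nonconst) (≡⇒≈ ∘ AB≡deq)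
      in xs , (i , λ xi≡0 → 0∤xi (subst (+ 0 ∣ˢ_) (sym xi≡0) ∣0)) , 0∣⇒≡0 0∣D
    where
    AB≡deq : ∀ k → PZ.coeff (PZ.mulP A B) k ≡ d * e * PZ.coeff (monicList c) k
    AB≡deq k = fromℤ-injective (begin
      fromℤ (PZ.coeff (PZ.mulP A B) k)                            ≡⟨ mulP-fromℤ (fromℤ d) (fromℤ e) A B a b A≡da B≡eb k ⟩
      fromℤ d ℚ.* fromℤ e ℚ.* PQ.coeff (PQ.mulP a b) k            ≡⟨ cong₂ ℚ._*_ (fromℤ-* d e) (trans (sym (coeff-toQ (monicList c) k)) (sym (ab≡q k))) ⟨
      fromℤ (d * e) ℚ.* fromℤ (PZ.coeff (monicList c) k)          ≡⟨ fromℤ-* (d * e) (PZ.coeff (monicList c) k) ⟨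
      fromℤ (d * e * PZ.coeff (monicList c) k)                    ∎)

-- Evaluation at a root and small solutions

module Evaluation (a : ℤ) where
  -- ℤ[x] / (x − a) is ℤ, and x acts on it as a.
  open QuotientRing {0} (λ _ → - a)
  open ≡-Reasoning

  evalZ-act : ∀ f → evalZ f a ≡ act f 𝟙 zero
  evalZ-act []       = refl
  evalZ-act (b ∷ bs) = cong₂ _+_ (sym (ℤ.*-identityʳ b))
    (trans (cong (a *_) (evalZ-act bs)) (lemma a (act bs 𝟙 zero)))
    where
    lemma : ∀ a x → a * x ≡ - (- a * x)
    lemma = solve-∀

  evalZ-coeff : ∀ f g → (∀ k → PZ.coeff f k ≡ PZ.coeff g k) → evalZ f a ≡ evalZ g a
  evalZ-coeff f g f≡g = trans (evalZ-act f) (trans (act-coeff ≡-isCongruence f g f≡g 𝟙 zero) (sym (evalZ-act g)))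

  evalZ-addP : ∀ f g → evalZ (PZ.addP f g) a ≡ evalZ f a + evalZ g a
  evalZ-addP f g = trans (evalZ-act (PZ.addP f g)) (trans (act-addP f g 𝟙 zero) (sym (cong₂ _+_ (evalZ-act f) (evalZ-act g))))

  evalZ-mulP : ∀ f g → evalZ (PZ.mulP f g) a ≡ evalZ f a * evalZ g a
  evalZ-mulP f g = begin
    evalZ (PZ.mulP f g) a                           ≡⟨ trans (evalZ-act (PZ.mulP f g)) (act-mulP f g 𝟙 zero) ⟩
    act f (act g 𝟙) zero                            ≡⟨ act-cong f scalar zero ⟩
    act f (λ i → x * 𝟙 i + + 0) zero                ≡⟨ act-linear f x 𝟙 (λ _ → + 0) zero ⟩
    x * act f 𝟙 zero + act f (λ _ → + 0) zero       ≡⟨ cong (λ z → x * act f 𝟙 zero + z) (act-zero f zero) ⟩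
    x * act f 𝟙 zero + + 0                          ≡⟨ trans (ℤ.+-identityʳ _) (ℤ.*-comm x _) ⟩
    act f 𝟙 zero * x                                ≡⟨ cong₂ _*_ (evalZ-act f) (evalZ-act g) ⟨
    evalZ f a * evalZ g a                           ∎
    where
    x = act g 𝟙 zero
    scalar : ∀ i → act g 𝟙 i ≡ x * 𝟙 i + + 0
    scalar zero = sym (trans (ℤ.+-identityʳ (x * + 1)) (ℤ.*-identityʳ x))

  evalZ-toList : ∀ {n} (w : Vector ℤ n) → evalZ (toList w) a ≡ ∑[ i < n ] (a ℤ.^ toℕ i * w i)
  evalZ-toList {zero}  w = refl
  evalZ-toList {suc n} w = cong₂ _+_ (sym (ℤ.*-identityˡ (w zero))) (begin
    a * evalZ (toList (w ∘ suc)) a                        ≡⟨ cong (a *_) (evalZ-toList (w ∘ suc)) ⟩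
    a * ∑[ i < n ] (a ℤ.^ toℕ i * w (suc i))              ≡⟨ *-distribˡ-sum a (λ i → a ℤ.^ toℕ i * w (suc i)) ⟩
    ∑[ i < n ] (a * (a ℤ.^ toℕ i * w (suc i)))            ≡⟨ sum-cong-≗ (λ i → sym (ℤ.*-assoc a (a ℤ.^ toℕ i) (w (suc i)))) ⟩
    ∑[ i < n ] (a * a ℤ.^ toℕ i * w (suc i))              ∎)

  evalZ-difference : ∀ {n} (v w : Vector ℤ n) → evalZ (toList (λ i → v i - w i)) a ≡ evalZ (toList v) a - evalZ (toList w) a
  evalZ-difference {zero}  v w = refl
  evalZ-difference {suc n} v w = trans (cong (λ z → v zero - w zero + a * z) (evalZ-difference (v ∘ suc) (w ∘ suc)))
    (lemma a (v zero) (w zero) (evalZ (toList (v ∘ suc)) a) (evalZ (toList (w ∘ suc)) a))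
    where
    lemma : ∀ a v w x y → v - w + a * (x - y) ≡ v + a * x - (w + a * y)
    lemma = solve-∀

-- Column j holds the remainder of x^j times the given polynomial on division by q. Weighting its
-- entries by powers of a gives the value of this remainder at a, a multiple of k because k divides
-- both given values. The first weight is 1, as `det-∣-combination` requires.
common-root⇒∣D : ∀ {k n} (c : Vector ℤ (suc n)) a xs → k ∣ˢ evalZ (monicList c) a → k ∣ˢ evalZ (toList xs) a → k ∣ˢ D c xs
common-root⇒∣D {k} {n} c a xs k∣q k∣x = subst (k ∣ˢ_) (sym (D-norm xs))
  (det-∣-combination {A = mulMatrix (toList xs)} (λ i → a ℤ.^ toℕ i) refl λ j → subst (k ∣ˢ_) (column j) (k∣remainder (product j) (k∣product j)))
  where
  open QuotientRing c
  open Division c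
  open Evaluation a
  open ≡-Reasoning
  q = monicList c
  k∣remainder : ∀ f → k ∣ˢ evalZ f a → k ∣ˢ evalZ (toList (remainder f)) a
  k∣remainder f k∣f = subst (k ∣ˢ_) (begin
    evalZ f a - evalZ (quotient f) a * evalZ q a ≡⟨ cong (_- evalZ (quotient f) a * evalZ q a) evalZ-division ⟩
    evalZ (quotient f) a * evalZ q a + evalZ (toList (remainder f)) a - evalZ (quotient f) a * evalZ q a ≡⟨ lemma (evalZ (quotient f) a * evalZ q a) _ ⟩
    evalZ (toList (remainder f)) a ∎)
    (∣m∣n⇒∣m-n k∣f (∣n⇒∣m*n (evalZ (quotient f) a) k∣q))
    where
    hq = PZ.mulP (quotient f) q
    r = toList (remainder f)
    lemma : ∀ x y → x + y - x ≡ y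
    lemma = solve-∀
    evalZ-division : evalZ f a ≡ evalZ (quotient f) a * evalZ q a + evalZ r a
    evalZ-division = begin
      evalZ f a                     ≡⟨ evalZ-coeff f (PZ.addP hq r) (λ k → trans (division f k) (sym (coeff-addP hq r k))) ⟩
      evalZ (PZ.addP hq r) a        ≡⟨ evalZ-addP hq r ⟩
      evalZ hq a + evalZ r a        ≡⟨ cong (_+ evalZ r a) (evalZ-mulP (quotient f) q) ⟩
      evalZ (quotient f) a * evalZ q a + evalZ r a ∎
  product : Fin (suc n) → List ℤ
  product j = PZ.mulP (toList xs) (toList (δ {n = suc n} j))
  k∣product : ∀ j → k ∣ˢ evalZ (product j) a
  k∣product j = subst (k ∣ˢ_) (sym (evalZ-mulP (toList xs) (toList (δ {n = suc n} j)))) (∣m⇒∣m*n _ k∣x)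
  column : ∀ j → evalZ (toList (remainder (product j))) a ≡ ∑[ i < suc n ] (a ℤ.^ toℕ i * act (toList xs) (δ j) i)
  column j = trans (evalZ-toList (remainder (product j))) (sum-cong-≗ λ i → cong (a ℤ.^ toℕ i *_)
    (trans (act-mulP (toList xs) (toList (δ j)) 𝟙 i) (act-cong (toList xs) (act-toList-δ (δ j)) i)))

-- The largest r with r ^ n < p satisfies p < (r + 1) ^ n, since a prime is not an n-th power.
root-bracket : ∀ {p} → Prime p → ∀ n → 2 ≤ n → ∃ λ r → r ^ n < p × p < suc r ^ n
root-bracket {p} p-prime n@(suc (suc n-2)) (s≤s (s≤s _)) = search p
  (ℕ.≤-trans (ℕ.≤-reflexive (sym (ℕ.^-identityʳ p))) (ℕ.^-monoʳ-≤ p {1} {n} (s≤s z≤n)))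
  where
  instance p-nonTrivial = prime⇒nonTrivial p-prime
  instance p-nonZero = ℕ.nonTrivial⇒nonZero p
  1<p : 1 < p
  1<p = ℕ.nonTrivial⇒n>1 p
  not-power : ∀ s → p ≢ s ^ n
  not-power s p≡sⁿ with prime⇒irreducible p-prime (subst (s ℕ.∣_) (sym p≡sⁿ) (ℕ.m∣m*n {s} (s ^ suc n-2)))
  ... | inj₁ refl = ℕ.<⇒≢ 1<p (sym (trans p≡sⁿ (ℕ.^-zeroˡ n)))
  ... | inj₂ refl = ℕ.<⇒≢ (ℕ.<-≤-trans (ℕ.m<m*n p p 1<p) (ℕ.≤-trans (ℕ.≤-reflexive (cong (p ℕ.*_) (sym (ℕ.*-identityʳ p))))
      (ℕ.^-monoʳ-≤ p {2} {n} (s≤s (s≤s z≤n))))) p≡sⁿ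
  -- The search starts at s = p, where p ≤ p ^ n, and goes down while this inequality persists.
  search : ∀ s → p ≤ s ^ n → ∃ λ r → r ^ n < p × p < suc r ^ n
  search zero    p≤0 = ⊥-elim (ℕ.<⇒≱ (ℕ.<-trans (s≤s z≤n) 1<p) p≤0)
  search (suc s) p≤s with s ^ n ℕ.<? p
  ... | yes sⁿ<p = s , sⁿ<p , ℕ.≤∧≢⇒< p≤s (not-power (suc s))
  ... | no sⁿ≮p  = search s (ℕ.≮⇒≥ sⁿ≮p)

small-residue-zero : ∀ {p} .{{_ : ℕ.NonZero p}} {r n} → p < suc r ^ n → ∀ a →
  ∃ λ (xs : Vector ℤ n) → (∃ λ i → xs i ≢ + 0) × + p ∣ˢ evalZ (toList xs) a × (∀ i → ℤ.∣ xs i ∣ ≤ r)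
small-residue-zero {p} {r} {n} p<rⁿ a = from-collision (pigeonhole p<rⁿ residue)
  where
  open ≡-Reasoning
  tuple : Fin (suc r ^ n) → Vector ℤ n
  tuple k i = + toℕ (finToFun {suc r} {n} k i)
  value : Fin (suc r ^ n) → ℤ
  value k = evalZ (toList (tuple k)) a
  residue : Fin (suc r ^ n) → Fin p
  residue k = fromℕ< (n%ℕd<d (value k) p)

  funToFin-cong : ∀ {m n} {f g : Fin m → Fin n} → f ≗ g → funToFin f ≡ funToFin g
  funToFin-cong {zero}  f≗g = refl
  funToFin-cong {suc m} f≗g = cong₂ combine (f≗g zero) (funToFin-cong (f≗g ∘ suc))

  from-collision : _ → _
  from-collision (k , l , k<l , rk≡rl) = xs , (proj₁ differ , λ xi≡0 → proj₂ differ (toℕ-injective (ℤ.+-injective (ℤ.i-j≡0⇒i≡j _ _ xi≡0))))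
    , subst (+ p ∣ˢ_) (sym (Evaluation.evalZ-difference a (tuple k) (tuple l))) (divides (value k /ℕ p - value l /ℕ p) values) , bound
    where
    xs : Vector ℤ n
    xs i = tuple k i - tuple l i
    differ : ∃ λ i → finToFun {suc r} {n} k i ≢ finToFun l i
    differ = ¬∀⟶∃¬ n _ (λ i → finToFun {suc r} {n} k i ≟F finToFun l i)
      λ eq → <⇒≢ k<l (trans (sym (funToFin-finToFin {n} {suc r} k)) (trans (funToFin-cong eq) (funToFin-finToFin {n} {suc r} l)))
    rem≡ : value k %ℕ p ≡ value l %ℕ p
    rem≡ = trans (sym (toℕ-fromℕ< _)) (trans (cong toℕ rk≡rl) (toℕ-fromℕ< _))
    values : value k - value l ≡ (value k /ℕ p - value l /ℕ p) * + p
    values = begin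
      value k - value l
        ≡⟨ cong₂ _-_ (a≡a%ℕn+[a/ℕn]*n (value k) p) (a≡a%ℕn+[a/ℕn]*n (value l) p) ⟩
      (+ (value k %ℕ p) + (value k /ℕ p) * + p) - (+ (value l %ℕ p) + (value l /ℕ p) * + p)
        ≡⟨ cong (λ t → (+ t + (value k /ℕ p) * + p) - (+ (value l %ℕ p) + (value l /ℕ p) * + p)) rem≡ ⟩
      (+ (value l %ℕ p) + (value k /ℕ p) * + p) - (+ (value l %ℕ p) + (value l /ℕ p) * + p)
        ≡⟨ lemma (+ (value l %ℕ p)) (value k /ℕ p) (value l /ℕ p) (+ p) ⟩
      (value k /ℕ p - value l /ℕ p) * + p ∎
      where
      lemma : ∀ t x y p → (t + x * p) - (t + y * p) ≡ (x - y) * p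
      lemma = solve-∀
    bound : ∀ i → ℤ.∣ xs i ∣ ≤ r
    bound i = ℕ.≤-trans (ℕ.≤-reflexive (cong ℤ.∣_∣ (ℤ.[+m]-[+n]≡m⊖n (toℕ u) (toℕ v))))
      (ℕ.≤-trans (ℤ.∣m⊝n∣≤m⊔n (toℕ u) (toℕ v)) (ℕ.⊔-lub (toℕ≤pred[n] u) (toℕ≤pred[n] v)))
      where
      u = finToFun {suc r} {n} k i
      v = finToFun {suc r} {n} l i

-- The statements of the theorem

-- Modulo p the coefficient list is congruent to `[]`, which acts as zero, so p divides every entry
-- of the matrix.
divisible⇒∣²D : ∀ {p n} (c : Vector ℤ (suc (suc n))) xs → (∀ i → + p ∣ˢ xs i) → + p * + p ∣ˢ D c xs
divisible⇒∣²D {p} {n} c xs p∣xs = subst (+ p * + p ∣ˢ_) (sym (D-norm xs)) (det-∣² {A = mulMatrix (toList xs)} λ i j →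
  ∣-resp-≈ (act-coeff ≈-isCongruence (toList xs) [] (λ k → ∣⇒≈0 (p∣coeff xs p∣xs k)) (δ j) i) ∣0)
  where
  open QuotientRing c
  p∣coeff : ∀ {m} (v : Vector ℤ m) → (∀ i → + p ∣ˢ v i) → ∀ k → + p ∣ˢ PZ.coeff (toList v) k
  p∣coeff {zero}  v p∣v k       = ∣0
  p∣coeff {suc m} v p∣v zero    = p∣v zero
  p∣coeff {suc m} v p∣v (suc k) = p∣coeff (v ∘ suc) (p∣v ∘ suc) k

p²∤p : ∀ {p} → Prime p → ¬ + p * + p ∣ˢ + p
p²∤p {p} p-prime p²∣p = p∤1 p-prime (*-cancelˡ-∣ (+ p) {{prime⇒nonZero p-prime}} (subst (+ p * + p ∣ˢ_) (sym (ℤ.*-identityʳ (+ p))) p²∣p))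

-- Comparing n-th powers expresses the bound by the real n-th root of p inside ℕ; it follows from ∣
-- x ∣ ≤ r and r ^ n < p.
bounded-zero : ∀ {p} → Prime p → ∀ n → 2 ≤ suc n → (c : Vector ℤ (suc n)) → ∀ a → + p ∣ˢ evalZ (monicList c) a →
  ∃ λ (xs : Vector ℤ (suc n)) → (∃ λ i → xs i ≢ + 0) × ((+ p) ∣ D c xs) × (∀ i → ∣ xs i ∣ ^ suc n < p)
bounded-zero p-prime n 2≤n c a p∣qa =
  let r , rⁿ<p , p<[r+1]ⁿ = root-bracket p-prime (suc n) 2≤n
      xs , xs≢0 , p∣x , xs≤r = small-residue-zero {{prime⇒nonZero p-prime}} p<[r+1]ⁿ a
  in xs , xs≢0 , ∣⇒∣ᵤ (common-root⇒∣D c a xs p∣qa p∣x) , λ i → ℕ.≤-<-trans (ℕ.^-monoˡ-≤ (suc n) (xs≤r i)) rⁿ<p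

irreducible⇒D≢p : ∀ {p} → Prime p → ∀ n → 2 ≤ suc n → (c : Vector ℤ (suc n)) → IrreducibleModP p (monicList c) →
  ∀ xs → D c xs ≢ + p
irreducible⇒D≢p {p} p-prime (suc n) 2≤n c irreducible xs D≡p = p²∤p p-prime (subst (+ p * + p ∣ˢ_) D≡p (divisible⇒∣²D c xs
  (irreducible⇒no-zero p-prime c irreducible xs (subst (+ p ∣ˢ_) (sym D≡p) (divides (+ 1) (sym (ℤ.*-identityˡ (+ p))))))))
irreducible⇒D≢p p-prime zero (s≤s ())

no-zero⇒irreducible : ∀ {p n} → Prime p → (c : Vector ℤ (suc n)) →
  ¬ (∃ λ (xs : Vector ℤ (suc n)) → (∃ λ i → ¬ ((+ p) ∣ xs i)) × ((+ p) ∣ D c xs)) → IrreducibleModP p (monicList c)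
no-zero⇒irreducible {p} p-prime c no-zero (a , b , a-nonconst , b-nonconst , ab≡q) =
  let xs , (i , p∤xi) , p∣D = factors⇒norm-zero (prime-modulus p-prime) c a b (+ 1) a-nonconst b-nonconst λ k →
        subst (PZ.coeff (PZ.mulP a b) k ≈_[ p ]) (sym (ℤ.*-identityˡ (PZ.coeff (monicList c) k))) (congruent (∣ᵤ⇒∣ (ab≡q k)))
  in no-zero (xs , (i , p∤xi ∘ ∣ᵤ⇒∣) , ∣⇒∣ᵤ p∣D)

theorem6p2 : (p : ℕ) → Prime p → (n : ℕ) → 0 < n → (c : Vector ℤ n) →
    (IrreducibleModP p (monicList c)
       ⇔ (¬ (∃ λ (xs : Vector ℤ n) → (∃ λ i → ¬ ((+ p) ∣ xs i)) × ((+ p) ∣ D c xs))))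
    × (ReducibleQ (monicList c)
       → ∃ λ (xs : Vector ℤ n) → (∃ λ i → xs i ≢ + 0) × D c xs ≡ + 0)
    × (2 ≤ n → (∃ λ (a : ℤ) → (+ p) ∣ evalZ (monicList c) a)
       → ∃ λ (xs : Vector ℤ n) → (∃ λ i → xs i ≢ + 0) × ((+ p) ∣ D c xs)
           × (∀ i → ∣ xs i ∣ ^ n < p))
    × (2 ≤ n → IrreducibleModP p (monicList c)
       → ¬ (∃ λ (xs : Vector ℤ n) → D c xs ≡ + p))
theorem6p2 p p-prime (suc n) _ c =
    mk⇔ (λ irreducible (xs , (i , p∤xi) , p∣D) → p∤xi (∣⇒∣ᵤ (irreducible⇒no-zero p-prime c irreducible xs (∣ᵤ⇒∣ p∣D) i)))
        (no-zero⇒irreducible p-prime c)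
  , reducibleℚ⇒norm-zero c
  , (λ 2≤n (a , p∣qa) → bounded-zero p-prime n 2≤n c a (∣ᵤ⇒∣ p∣qa))
  , (λ 2≤n irreducible (xs , D≡p) → irreducible⇒D≢p p-prime n 2≤n c irreducible xs D≡p)
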